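{- Let $k\geq 1$ and $m\geq 1$ be integers, and let $A=\{a_s(n_s)\}_{s=1}^k$ be a finite system of residue classes (with $a_s\in\mathbb{Z}$, $n_s\in\mathbb{Z}_{>0}$) such that $A$ is an $m$-cover of the integers with the residue class $a_k(n_k)$ irredundant. Suppose that the covering function $w_A$ is periodic modulo $n_k$, i.e. $w_A(x+n_k)=w_A(x)$ for all $x\in\mathbb{Z}$. Then for every $r\in\{0,1,\ldots,n_k-1\}$, $$\bigg|\bigg\{\bigg\lfloor\sum_{s\in I}\frac1{n_s}\bigg\rfloor:\ I\subseteq\{1,\ldots,k-1\}\ \text{and}\ \bigg\{\sum_{s\in I}\frac1{n_s}\bigg\}=\frac r{n_k}\bigg\}\bigg|\geq m,$$ where $\lfloor\alpha\rfloor$ and $\{\alpha\}$ denote the integral part and the fractional part of a real number $\alpha$.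
   Context: For integers $a$ and $n>0$, $a(n)$ denotes the residue class $\{x\in\mathbb{Z}: x\equiv a \pmod n\}$. For a system $A=\{a_s(n_s)\}_{s=1}^k$, the covering function is $w_A(x)=|\{1\leq s\leq k: x\in a_s(n_s)\}|$ for $x\in\mathbb{Z}$. $A$ is an $m$-cover of the integers if $w_A(x)\geq m$ for all $x\in\mathbb{Z}$. $A$ forms an $m$-cover of the integers with $a_t(n_t)$ irredundant if $A$ is an $m$-cover of the integers but the system $\{a_s(n_s)\}_{s\in\{1,\ldots,k\}\setminus\{t\}}$ is not. An empty sum equals $0$. -}

module Defs where

open import Data.Nat using (ℕ; zero; suc)
import Data.Nat as ℕ
open import Data.Integer using (ℤ; +_; _-_)
open import Data.Integer.Divisibility.Signed using (_∣_; _∣?_)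
open import Data.Rational using (ℚ; 0ℚ; 1ℚ; _+_; floor) renaming (_-_ to _-ℚ_; _/_ to _/ℚ_)
open import Data.Fin using (Fin; zero; suc)
open import Data.Fin.Subset using (Subset)
open import Data.Vec using ([]; _∷_)
open import Data.Bool using (if_then_else_)
open import Relation.Nullary.Decidable using (does)

w : {k : ℕ} → (a : Fin k → ℤ) → (n : Fin k → ℕ) → ℤ → ℕ
w {zero} a n x = 0
w {suc k} a n x =
  (if does ((+ n zero) ∣? (x - a zero)) then 1 else 0) ℕ.+ w (λ s → a (suc s)) (λ s → n (suc s)) x

IsMCover : {k : ℕ} → ℕ → (Fin k → ℤ) → (Fin k → ℕ) → Set
IsMCover m a n = ∀ (x : ℤ) → m ℕ.≤ w a n x

-- 1/n as a rational (the value at 0 is irrelevant: moduli are positive)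
recip : ℕ → ℚ
recip zero = 0ℚ
recip (suc d) = (+ 1) /ℚ (suc d)

sumInv : {j : ℕ} → (Fin j → ℕ) → Subset j → ℚ
sumInv {zero} n [] = 0ℚ
sumInv {suc j} n (b ∷ I) = (if b then recip (n zero) else 0ℚ) + sumInv (λ s → n (suc s)) I

frac : ℚ → ℚ
frac p = p -ℚ ((floor p) /ℚ 1)

-- Let A′ be A without a_k(n_k), and μ = m - 1. The hypotheses make the covering function of A′
-- periodic modulo n_k, equal to μ on a_k(n_k) and larger elsewhere. Let N be a common multiple of the
-- moduli and E t the t-th power of a primitive N-th root of unity in a domain. The polynomial
-- ∏_s (1 - E(-a_s N/n_s) z^(N/n_s)) has the exponents N ∑_{s ∈ I} 1/n_s, and it vanishes at E x to the
-- order w(x) of the covering at x, with a leading coefficient there that is the product of the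
-- (1 - E u)^w(x - u) over 0 < u < N, hence depends only on x modulo n_k. If fewer than m exponents were
-- congruent to r N/n_k modulo N, some polynomial f of degree μ would vanish on them. Apply f(z d/dz) and
-- select these exponents by the sum over all x modulo N with weights E(-x r N/n_k): the result is 0,
-- but only x in a_k(n_k) contribute, and all of them contribute the same nonzero element.
-- The domain is ℤ/p for a prime p with N | p - 1 that divides neither N nor μ!; such a p is found among
-- the divisors of b^N - 1 for a suitable multiple b of N μ!.
module Submission where

open import Defs
open import Algebra.Bundles using (CommutativeMonoid; CommutativeRing)
open import Algebra.Solver.Ring.AlmostCommutativeRing using (_-Raw-AlmostCommutative⟶_; fromCommutativeRing)
open import Data.Bool using (true; false; if_then_else_)
open import Data.Empty using (⊥; ⊥-elim)
open import Data.Fin using (Fin; zero; suc; inject₁; fromℕ)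
open import Data.Fin.Subset using (Subset)
open import Data.Fin.Subset.Properties using (anySubset?)
open import Data.Integer as ℤ using (ℤ; +_)
open import Data.Integer.DivMod using (_%ℕ_; _/ℕ_; n%ℕd<d; a≡a%ℕn+[a/ℕn]*n; div-pos-is-/ℕ)
open import Data.Integer.Divisibility.Signed
import Data.Integer.Properties as ℤ
open import Data.Integer.Tactic.RingSolver using (solve-∀)
open import Data.List using (List; []; _∷_; length; filter; upTo)
import Data.List.Membership.Propositional as List
open import Data.List.Membership.Propositional.Properties using (∈-filter⁺; ∈-upTo⁺)
open import Data.List.Relation.Unary.All as All using (All; []; _∷_)
open import Data.List.Relation.Unary.All.Properties using (all-filter)
open import Data.List.Relation.Unary.AllPairs using ([]; _∷_)
open import Data.List.Relation.Unary.Any using (here; there)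
open import Data.List.Relation.Unary.Unique.Propositional using (Unique)
open import Data.List.Relation.Unary.Unique.Propositional.Properties using (upTo⁺; filter⁺)
import Data.Maybe as Maybe
open import Data.Nat as ℕ using (ℕ; zero; suc; _!)
import Data.Nat.Divisibility as ℕ
import Data.Nat.DivMod as ℕ
open import Data.Nat.GCD using (gcd; gcd[m,n]∣m; gcd[m,n]∣n; gcd-greatest; gcd-GCD; module Bézout)
open import Data.Nat.ListAction using (product)
open import Data.Nat.Primality using (Prime; prime?; euclidsLemma; prime⇒nonZero; ¬prime[1])
open import Data.Nat.Primality.Factorisation using (factorise; factorisationHasAllPrimeFactors)
import Data.Nat.Properties as ℕ
import Data.Nat.Tactic.RingSolver as ℕ
open import Data.Product using (Σ; ∃; _×_; _,_; proj₁; proj₂)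
open import Data.Rational as ℚ using (ℚ; floor)
import Data.Rational.Properties as ℚ
open import Data.Rational.Unnormalised as ℚᵘ using (mkℚᵘ; *≡*)
import Data.Rational.Unnormalised.Properties as ℚᵘ
open import Data.Sum as Sum using (_⊎_; inj₁; inj₂)
open import Data.Vec using (Vec; []; _∷_; tabulate)
open import Data.Vec.Membership.DecPropositional ℕ._≟_ using (_∈?_)
open import Data.Vec.Membership.Propositional using (_∈_)
open import Data.Vec.Membership.Propositional.Properties using (∈-tabulate⁺)
open import Data.Vec.Relation.Unary.Any using (here; there)
open import Function using (_∘_; mk⇔)
open import Level using (0ℓ)
open import Relation.Binary.PropositionalEquality as ≡ using (_≡_; _≢_; cong; cong₂; subst)
open import Relation.Nullary using (¬_; Dec; yes; no; ¬?)
open import Relation.Nullary.Decidable using (does; dec-true; dec-false; does-⇔; dec⇒maybe; decidable-stable; _×-dec_)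

-- Roots of unity enter only through exact equalities in a domain, so a prime field can replace the
-- complex numbers, provided that p kills neither μ! nor the numbers N/n_s, which are factors of the
-- final nonzero value. All of them divide N μ!. For b a multiple of N μ! this is automatic: p
-- divides b^N - 1, so it does not divide b. Moreover, b must have order exactly N modulo p, that
-- is, p must divide no b^(N/q) - 1 with q a prime divisor of N. A size argument replaces cyclotomic
-- polynomials here. Expand the product of these numbers and reduce the exponents modulo N: the
-- result is a signed sum of powers b^c with c < N, and exactly one of them is b^0. Hence it is 1 or
-- -1 modulo b, so it is nonzero; for large b it is smaller than b^N - 1. So b^N - 1 does not divide
-- the product, and the part of it beyond the gcd supplies p. The operator z d/dz is preferred to
-- d/dz because it multiplies each monomial by a scalar. Its effect at one point can then be written
-- with finite differences of f alone, and no polynomial in z has to be represented.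

i-[i-j]≡j : ∀ i j → i ℤ.- (i ℤ.- j) ≡ j
i-[i-j]≡j = solve-∀

m∣n∧n<m⇒n≡0 : ∀ {m n} → m ℕ.∣ n → n ℕ.< m → n ≡ 0
m∣n∧n<m⇒n≡0 {n = zero}  m∣n n<m = ≡.refl
m∣n∧n<m⇒n≡0 {n = suc n} m∣n n<m = ⊥-elim (ℕ.>⇒∤ n<m m∣n)

flip-∣ : ∀ {n x y} → + n ∣ x ℤ.- y → + n ∣ y ℤ.- x
flip-∣ {n} {x} {y} n∣ = subst (+ n ∣_) (flip x y) (∣m⇒∣-m n∣)
  where
  flip : ∀ x y → ℤ.- (x ℤ.- y) ≡ y ℤ.- x
  flip = solve-∀

∣-∸ : ∀ {n i k} → k ℕ.≤ i → + n ∣ + i ℤ.- + k → n ℕ.∣ i ℕ.∸ k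
∣-∸ {n} {i} {k} k≤i n∣i-k = ∣⇒∣ᵤ (subst (+ n ∣_) (≡.trans (ℤ.m-n≡m⊖n i k) (ℤ.⊖-≥ k≤i)) n∣i-k)

residue-unique : ∀ {n i k} → i ℕ.< n → k ℕ.< n → + n ∣ + i ℤ.- + k → i ≡ k
residue-unique {n} {i} {k} i<n k<n n∣i-k with ℕ.≤-total k i
... | inj₁ k≤i = ℕ.≤-antisym (ℕ.m∸n≡0⇒m≤n (m∣n∧n<m⇒n≡0 (∣-∸ k≤i n∣i-k) (ℕ.≤-<-trans (ℕ.m∸n≤m i k) i<n))) k≤i
... | inj₂ i≤k = ℕ.≤-antisym i≤k (ℕ.m∸n≡0⇒m≤n
  (m∣n∧n<m⇒n≡0 (∣-∸ i≤k (flip-∣ {x = + i} {+ k} n∣i-k)) (ℕ.≤-<-trans (ℕ.m∸n≤m k i) k<n)))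

residue-∣ : ∀ n .{{_ : ℕ.NonZero n}} y t → + n ∣ y ℤ.- + (t ℕ.* n ℕ.+ y %ℕ n)
residue-∣ n y t = divides (y /ℕ n ℤ.- + t) (begin
  y ℤ.- + (t ℕ.* n ℕ.+ r)
    ≡⟨ ≡.cong₂ (λ i k → i ℤ.- k) (a≡a%ℕn+[a/ℕn]*n y n)
         (≡.trans (ℤ.pos-+ (t ℕ.* n) r) (cong (ℤ._+ + r) (ℤ.pos-* t n))) ⟩
  + r ℤ.+ (y /ℕ n) ℤ.* + n ℤ.- (+ t ℤ.* + n ℤ.+ + r)   ≡⟨ factor (+ r) (y /ℕ n) (+ n) (+ t) ⟩
  (y /ℕ n ℤ.- + t) ℤ.* + n                             ∎)
  where
  open ≡.≡-Reasoning
  r = y %ℕ n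
  factor : ∀ r q n t → r ℤ.+ q ℤ.* n ℤ.- (t ℤ.* n ℤ.+ r) ≡ (q ℤ.- t) ℤ.* n
  factor = solve-∀

-- Sums and products over initial segments of the natural numbers.

module RangeFold (M : CommutativeMonoid 0ℓ 0ℓ) where
  open CommutativeMonoid M
  open import Relation.Binary.Reasoning.Setoid setoid
  open import Algebra.Properties.CommutativeSemigroup commutativeSemigroup using (interchange)

  fold : ℕ → (ℕ → Carrier) → Carrier
  fold zero    f = ε
  fold (suc n) f = f 0 ∙ fold n (f ∘ suc)

  fold-cong< : ∀ n {f g} → (∀ i → i ℕ.< n → f i ≈ g i) → fold n f ≈ fold n g
  fold-cong< zero    f≈g = refl
  fold-cong< (suc n) f≈g = ∙-cong (f≈g 0 ℕ.z<s) (fold-cong< n λ i i<n → f≈g (suc i) (ℕ.s<s i<n))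

  fold-cong : ∀ n {f g} → (∀ i → f i ≈ g i) → fold n f ≈ fold n g
  fold-cong n f≈g = fold-cong< n λ i _ → f≈g i

  fold-ε : ∀ n {f} → (∀ i → i ℕ.< n → f i ≈ ε) → fold n f ≈ ε
  fold-ε zero    f≈ε = refl
  fold-ε (suc n) f≈ε =
    trans (∙-cong (f≈ε 0 ℕ.z<s) (fold-ε n λ i i<n → f≈ε (suc i) (ℕ.s<s i<n))) (identityˡ ε)

  fold-∙ : ∀ n f g → fold n (λ i → f i ∙ g i) ≈ fold n f ∙ fold n g
  fold-∙ zero    f g = sym (identityˡ ε)
  fold-∙ (suc n) f g = trans (∙-congˡ (fold-∙ n (f ∘ suc) (g ∘ suc))) (interchange _ _ _ _)

  fold-+ : ∀ m n f → fold (m ℕ.+ n) f ≈ fold m f ∙ fold n (λ i → f (m ℕ.+ i))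
  fold-+ zero    n f = sym (identityˡ _)
  fold-+ (suc m) n f = trans (∙-congˡ (fold-+ m n (f ∘ suc))) (sym (assoc _ _ _))

  fold-* : ∀ h n f → fold (h ℕ.* n) f ≈ fold h (λ t → fold n (λ i → f (t ℕ.* n ℕ.+ i)))
  fold-* zero    n f = refl
  fold-* (suc h) n f = begin
    fold (n ℕ.+ h ℕ.* n) f                            ≈⟨ fold-+ n (h ℕ.* n) f ⟩
    fold n f ∙ fold (h ℕ.* n) (λ i → f (n ℕ.+ i))     ≈⟨ ∙-congˡ (fold-* h n _) ⟩
    fold n f ∙ fold h (λ t → fold n (λ i → f (n ℕ.+ (t ℕ.* n ℕ.+ i))))
      ≈⟨ ∙-congˡ (fold-cong h λ t → fold-cong n λ i → reflexive (cong f (≡.sym (ℕ.+-assoc n _ i)))) ⟩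
    fold n f ∙ fold h (λ t → fold n (λ i → f (suc t ℕ.* n ℕ.+ i))) ∎

  fold-single : ∀ n {f} k → k ℕ.< n → (∀ i → i ℕ.< n → i ≢ k → f i ≈ ε) → fold n f ≈ f k
  fold-single (suc n) zero    k<n f≈ε =
    trans (∙-congˡ (fold-ε n λ i i<n → f≈ε (suc i) (ℕ.s<s i<n) λ ())) (identityʳ _)
  fold-single (suc n) (suc k) k<n f≈ε =
    trans (∙-cong (f≈ε 0 ℕ.z<s λ ())
                  (fold-single n k (ℕ.s<s⁻¹ k<n) λ i i<n i≢k → f≈ε (suc i) (ℕ.s<s i<n) (i≢k ∘ ℕ.suc-injective)))
          (identityˡ _)

  -- Each of the h blocks of n consecutive numbers contains exactly one u congruent to y. The
  -- additive instance counts the points of a residue class below N, the multiplicative one collects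
  -- the roots of unity that belong to a class.
  fold-residue : ∀ h n .{{_ : ℕ.NonZero n}} (y : ℤ) (F : ℕ → Carrier) →
    fold (h ℕ.* n) (λ u → if does (+ n ∣? y ℤ.- + u) then F u else ε) ≈ fold h (λ t → F (t ℕ.* n ℕ.+ y %ℕ n))
  fold-residue h n y F = trans (fold-* h n _) (fold-cong h λ t →
    trans (fold-single n (y %ℕ n) (n%ℕd<d y n) (miss t)) (reflexive (hit t)))
    where
    r = y %ℕ n
    hit : ∀ t → (if does (+ n ∣? y ℤ.- + (t ℕ.* n ℕ.+ r)) then F (t ℕ.* n ℕ.+ r) else ε) ≡ F (t ℕ.* n ℕ.+ r)
    hit t = cong (if_then F (t ℕ.* n ℕ.+ r) else ε) (dec-true (+ n ∣? _) (residue-∣ n y t))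
    miss : ∀ t i → i ℕ.< n → i ≢ r → (if does (+ n ∣? y ℤ.- + (t ℕ.* n ℕ.+ i)) then F (t ℕ.* n ℕ.+ i) else ε) ≈ ε
    miss t i i<n i≢r = reflexive (cong (if_then F (t ℕ.* n ℕ.+ i) else ε) (dec-false (+ n ∣? _) λ n∣ →
      i≢r (residue-unique i<n (n%ℕd<d y n) (subst (+ n ∣_) (cancel i)
        (∣m∣n⇒∣m-n (residue-∣ n y t) n∣)))))
      where
      rearrange : ∀ y a r i → y ℤ.- (a ℤ.+ r) ℤ.- (y ℤ.- (a ℤ.+ i)) ≡ i ℤ.- r
      rearrange = solve-∀
      cancel : ∀ i → y ℤ.- + (t ℕ.* n ℕ.+ r) ℤ.- (y ℤ.- + (t ℕ.* n ℕ.+ i)) ≡ + i ℤ.- + r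
      cancel i = ≡.trans (≡.cong₂ (λ a b → y ℤ.- a ℤ.- (y ℤ.- b)) (ℤ.pos-+ (t ℕ.* n) r) (ℤ.pos-+ (t ℕ.* n) i))
                         (rearrange y (+ (t ℕ.* n)) (+ r) (+ i))

-- Powers, geometric sums and polynomial functions over a commutative ring.

module Powers (R : CommutativeRing 0ℓ 0ℓ) where
  open CommutativeRing R
  open import Algebra.Properties.Semiring.Exp semiring public using (_^_; ^-congˡ; ^-assocʳ; ^-homo-*)

  1^ : ∀ n → 1# ^ n ≈ 1#
  1^ zero    = refl
  1^ (suc n) = trans (*-identityˡ _) (1^ n)

module IntegerAlgebra (R : CommutativeRing 0ℓ 0ℓ) (morphism : ℤ.+-*-rawRing -Raw-AlmostCommutative⟶ fromCommutativeRing R) where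
  open CommutativeRing R
  open _-Raw-AlmostCommutative⟶_ morphism public
    renaming (⟦_⟧ to ι; +-homo to ι-+; *-homo to ι-*; -‿homo to ι-neg; 0-homo to ι-0; 1-homo to ι-1)
  open import Algebra.Solver.Ring ℤ.+-*-rawRing (fromCommutativeRing R) morphism
    (λ i j → Maybe.map (reflexive ∘ cong ι) (dec⇒maybe (i ℤ.≟ j))) public
    using (solve; _:=_; _:+_; _:*_; _:-_; :-_; con; Polynomial)
  open Powers R public
  open RangeFold +-commutativeMonoid public using ()
    renaming (fold to ∑; fold-cong to ∑-cong; fold-ε to ∑-zero; fold-residue to ∑-residue)
  open RangeFold *-commutativeMonoid public using ()
    renaming (fold to ∏; fold-cong to ∏-cong; fold-ε to ∏-one; fold-∙ to ∏-*; fold-residue to ∏-residue)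
  open import Relation.Binary.Reasoning.Setoid setoid

  one : ∀ {n} → Polynomial n
  one = con (+ 1)

  sub-cong : ∀ {x y u v} → x ≈ y → u ≈ v → x - u ≈ y - v
  sub-cong x≈y u≈v = +-cong x≈y (-‿cong u≈v)

  ∑-scale : ∀ n c f → ∑ n (λ i → c * f i) ≈ c * ∑ n f
  ∑-scale zero    c f = sym (zeroʳ c)
  ∑-scale (suc n) c f = trans (+-congˡ (∑-scale n c (f ∘ suc))) (sym (distribˡ c _ _))

  ∑-sub : ∀ n f g → ∑ n (λ i → f i - g i) ≈ ∑ n f - ∑ n g
  ∑-sub zero    f g = sym (-‿inverseʳ 0#)
  ∑-sub (suc n) f g = trans (+-congˡ (∑-sub n (f ∘ suc) (g ∘ suc)))
    (solve 4 (λ a b c d → a :- b :+ (c :- d) := a :+ c :- (b :+ d)) refl _ _ _ _)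

  geometric : ∀ n z → (1# - z) * ∑ n (λ i → z ^ i) ≈ 1# - z ^ n
  geometric zero    z = trans (zeroʳ _) (sym (-‿inverseʳ 1#))
  geometric (suc n) z = begin
    (1# - z) * (1# + ∑ n (λ i → z * z ^ i))   ≈⟨ *-congˡ (+-congˡ (∑-scale n z (z ^_))) ⟩
    (1# - z) * (1# + z * ∑ n (z ^_))
      ≈⟨ solve 3 (λ z s i → (i :- z) :* (i :+ z :* s) := i :* (i :- z) :+ z :* ((i :- z) :* s)) refl z _ 1# ⟩
    1# * (1# - z) + z * ((1# - z) * ∑ n (z ^_))    ≈⟨ +-cong (*-identityˡ _) (*-congˡ (geometric n z)) ⟩
    1# - z + z * (1# - z ^ n)                 ≈⟨ +-congˡ (trans (distribˡ _ _ _) (+-congʳ (*-identityʳ z))) ⟩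
    1# - z + (z + z * - (z ^ n))
      ≈⟨ solve 3 (λ i z s → i :- z :+ (z :+ z :* (:- s)) := i :- z :* s) refl 1# z _ ⟩
    1# - z ^ suc n                            ∎

  -- f agrees with a polynomial of degree at most d whose y^d-coefficient is ℓ.
  data Poly : ℕ → Carrier → (Carrier → Carrier) → Set where
    constant : ∀ {ℓ f} → (∀ y → f y ≈ ℓ) → Poly 0 ℓ f
    horner   : ∀ {d ℓ f} c g → Poly d ℓ g → (∀ y → f y ≈ c + y * g y) → Poly (suc d) ℓ f

  Poly-cong : ∀ {d ℓ ℓ′ f f′} → ℓ ≈ ℓ′ → (∀ y → f y ≈ f′ y) → Poly d ℓ f → Poly d ℓ′ f′
  Poly-cong ℓ≈ f≈ (constant P) = constant λ y → trans (sym (f≈ y)) (trans (P y) ℓ≈)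
  Poly-cong ℓ≈ f≈ (horner c g P eq) =
    horner c g (Poly-cong ℓ≈ (λ _ → refl) P) λ y → trans (sym (f≈ y)) (eq y)

  Poly-+ : ∀ {d ℓ ℓ′ f f′} → Poly d ℓ f → Poly d ℓ′ f′ → Poly d (ℓ + ℓ′) (λ y → f y + f′ y)
  Poly-+ (constant P) (constant P′) = constant λ y → +-cong (P y) (P′ y)
  Poly-+ (horner c g P eq) (horner c′ g′ P′ eq′) =
    horner (c + c′) (λ y → g y + g′ y) (Poly-+ P P′) λ y → trans (+-cong (eq y) (eq′ y))
      (solve 5 (λ c c′ y u v → c :+ y :* u :+ (c′ :+ y :* v) := c :+ c′ :+ y :* (u :+ v)) refl _ _ _ _ _)

  Poly-scale : ∀ {d ℓ f} k → Poly d ℓ f → Poly d (k * ℓ) (λ y → k * f y)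
  Poly-scale k (constant P) = constant λ y → *-congˡ (P y)
  Poly-scale k (horner c g P eq) =
    horner (k * c) (λ y → k * g y) (Poly-scale k P) λ y → trans (*-congˡ (eq y))
      (solve 4 (λ k c y u → k :* (c :+ y :* u) := k :* c :+ y :* (k :* u)) refl _ _ _ _)

  -- The index only bounds the degree, so it may grow at the price of a zero leading coefficient.
  -- This brings lower-order terms to the common index that `Poly-+` requires.
  Poly-raise : ∀ {d ℓ f} → Poly d ℓ f → Poly (suc d) 0# f
  Poly-raise (constant {ℓ} P) = horner ℓ (λ _ → 0#) (constant λ _ → refl)
    λ y → trans (P y) (sym (trans (+-congˡ (zeroʳ y)) (+-identityʳ ℓ)))
  Poly-raise (horner c g P eq) = horner c g (Poly-raise P) eq

  Poly-linear* : ∀ {d ℓ f} α β → Poly d ℓ f → Poly (suc d) (β * ℓ) (λ y → (α + β * y) * f y)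
  Poly-linear* {f = f} α β P = Poly-cong (trans (+-congʳ (zeroʳ α)) (+-identityˡ _))
    (λ y → trans (+-congˡ (+-identityˡ _))
      (solve 4 (λ α β y u → α :* u :+ y :* (β :* u) := (α :+ β :* y) :* u) refl α β y (f y)))
    (Poly-+ (Poly-scale α (Poly-raise P)) (horner 0# (λ y → β * f y) (Poly-scale β P) λ _ → refl))

  -- In c + y g(y - h) - h g(y - h) the last term has smaller degree, so the leading coefficient
  -- survives the shift.
  Poly-shift : ∀ {d ℓ f} h → Poly d ℓ f → Poly d ℓ (λ y → f (y - h))
  Poly-shift h (constant P) = constant λ y → P (y - h)
  Poly-shift h (horner c g P eq) =
    Poly-cong (trans (+-congˡ (zeroʳ (- h))) (+-identityʳ _))
      (λ y → sym (trans (eq (y - h))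
        (solve 4 (λ c h y u → c :+ (y :- h) :* u := c :+ y :* u :+ :- h :* u) refl c h y _)))
      (Poly-+ (horner c (λ y → g (y - h)) (Poly-shift h P) λ _ → refl)
              (Poly-scale (- h) (Poly-raise (Poly-shift h P))))

  -- By the product rule y g(y) - (y - h) g(y - h) = y (g(y) - g(y - h)) + h g(y - h), the factor d
  -- + 1 grows by one at each stage. Iterated differences thus produce the factorial in
  -- `signedSum-leading`.
  Poly-difference : ∀ {d ℓ f} h → Poly (suc d) ℓ f → Poly d (ι (+ suc d) * h * ℓ) (λ y → f y - f (y - h))
  Poly-difference {ℓ = ℓ} {f} h (horner c g (constant P) eq) = constant λ y → begin
    f y - f (y - h)                                ≈⟨ sub-cong (eq y) (eq (y - h)) ⟩
    c + y * g y - (c + (y - h) * g (y - h))        ≈⟨ sub-cong (+-congˡ (*-congˡ (P y))) (+-congˡ (*-congˡ (P (y - h)))) ⟩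
    c + y * ℓ - (c + (y - h) * ℓ)
      ≈⟨ solve 4 (λ c y h u → c :+ y :* u :- (c :+ (y :- h) :* u) := one :* h :* u) refl c y h ℓ ⟩
    ι (+ 1) * h * ℓ                                ∎
  Poly-difference {suc d} {ℓ} {f} h (horner c g P@(horner _ _ _ _) eq) =
    Poly-cong (trans (solve 3 (λ e h ℓ → e :* h :* ℓ :+ h :* ℓ := (one :+ e) :* h :* ℓ) refl (ι (+ suc d)) h ℓ)
                     (*-congʳ (*-congʳ (sym (ι-+ (+ 1) (+ suc d))))))
      (λ y → sym (trans (sub-cong (eq y) (eq (y - h))) (trans
        (solve 5 (λ c y h u v → c :+ y :* u :- (c :+ (y :- h) :* v) := y :* (u :- v) :+ h :* v) refl c y h _ _)
        (+-congʳ (sym (+-identityˡ _))))))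
      (Poly-+ (horner 0# (λ y → g y - g (y - h)) (Poly-difference h P) λ _ → refl)
              (Poly-scale h (Poly-shift h P)))

  -- Synthetic division by y - r; the quotient inherits the leading coefficient.
  Poly-factor : ∀ {d ℓ f} r → Poly (suc d) ℓ f →
                Σ (Carrier → Carrier) λ g → Poly d ℓ g × (∀ y → f y ≈ f r + (y - r) * g y)
  Poly-factor {f = f} r (horner c g (constant P) eq) = g , constant P , λ y → begin
    f y                              ≈⟨ eq y ⟩
    c + y * g y                      ≈⟨ +-congˡ (*-congˡ (trans (P y) (sym (P r)))) ⟩
    c + y * g r                      ≈⟨ solve 4 (λ c y r u → c :+ y :* u := c :+ r :* u :+ (y :- r) :* u) refl c y r (g r) ⟩
    c + r * g r + (y - r) * g r      ≈⟨ +-cong (eq r) (*-congˡ (trans (P y) (sym (P r)))) ⟨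
    f r + (y - r) * g y              ∎
  Poly-factor {f = f} r (horner c g P@(horner _ _ _ _) eq) with Poly-factor r P
  ... | g′ , P′ , eq′ = (λ y → g r + y * g′ y) , horner (g r) g′ P′ (λ _ → refl) , λ y → begin
    f y                                          ≈⟨ eq y ⟩
    c + y * g y                                  ≈⟨ +-congˡ (*-congˡ (eq′ y)) ⟩
    c + y * (g r + (y - r) * g′ y)
      ≈⟨ solve 5 (λ c y r u v → c :+ y :* (u :+ (y :- r) :* v) := c :+ r :* u :+ (y :- r) :* (u :+ y :* v))
           refl c y r (g r) (g′ y) ⟩
    c + r * g r + (y - r) * (g r + y * g′ y)     ≈⟨ +-congʳ (eq r) ⟨
    f r + (y - r) * (g r + y * g′ y)             ∎

-- Domains with a primitive N-th root of unity.

record CyclotomicDomain (N : ℕ) : Set₁ where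
  field
    commutativeRing : CommutativeRing 0ℓ 0ℓ
    morphism : ℤ.+-*-rawRing -Raw-AlmostCommutative⟶ fromCommutativeRing commutativeRing
  open CommutativeRing commutativeRing using (Carrier; _≈_; _*_; 0#; 1#)
  field
    no-zero-divisors : ∀ {x y} → x * y ≈ 0# → x ≈ 0# ⊎ y ≈ 0#
    1≉0              : ¬ (1# ≈ 0#)
    -- E t plays the role of exp (2πi t / N).
    E                : ℤ → Carrier
    E-+              : ∀ s t → E (s ℤ.+ t) ≈ E s * E t
    E≈1⇒∣            : ∀ {t} → E t ≈ 1# → + N ∣ t
    ∣⇒E≈1            : ∀ {t} → + N ∣ t → E t ≈ 1#

module Cyclotomic {N : ℕ} (D : CyclotomicDomain N) where
  open CyclotomicDomain D public
  open CommutativeRing commutativeRing public hiding (zero)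
  open IntegerAlgebra commutativeRing morphism public
  open import Algebra.Properties.Ring ring using (-1*x≈-x; -0#≈0#)
  open import Relation.Binary.Reasoning.Setoid setoid

  NonzeroDivisors : ℕ → Set
  NonzeroDivisors K = ∀ {i} → i ℕ.∣ K → ι (+ i) ≉ 0#

  difference≈0 : ∀ {x y} → x - y ≈ 0# → x ≈ y
  difference≈0 {x} {y} x-y≈0 = begin
    x            ≈⟨ solve 2 (λ x y → x := y :+ (x :- y)) refl x y ⟩
    y + (x - y)  ≈⟨ +-congˡ x-y≈0 ⟩
    y + 0#       ≈⟨ +-identityʳ y ⟩
    y            ∎

  ≈⇒difference≈0 : ∀ {x y} → x ≈ y → x - y ≈ 0#
  ≈⇒difference≈0 {x} {y} x≈y = trans (+-congʳ x≈y) (-‿inverseʳ y)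

  cancelˡ : ∀ {x y} → x ≉ 0# → x * y ≈ 0# → y ≈ 0#
  cancelˡ x≉0 xy≈0 with no-zero-divisors xy≈0
  ... | inj₁ x≈0 = ⊥-elim (x≉0 x≈0)
  ... | inj₂ y≈0 = y≈0

  *-≉0 : ∀ {x y} → x ≉ 0# → y ≉ 0# → x * y ≉ 0#
  *-≉0 x≉0 y≉0 xy≈0 = y≉0 (cancelˡ x≉0 xy≈0)

  -- Dividing by y - r 0 leaves a quotient that vanishes at the remaining d roots, because the
  -- differences r (i + 1) - r 0 can be cancelled in a domain.
  Poly-roots : ∀ d {ℓ f} (r : ℕ → Carrier) → Poly d ℓ f →
               (∀ {i k} → i ℕ.< k → k ℕ.≤ d → r k ≉ r i) →
               (∀ {i} → i ℕ.≤ d → f (r i) ≈ 0#) → ∀ y → f y ≈ 0#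
  Poly-roots zero    r (constant P) distinct root y = trans (trans (P y) (sym (P (r 0)))) (root ℕ.z≤n)
  Poly-roots (suc d) {f = f} r P distinct root y with Poly-factor (r 0) P
  ... | g , Pg , eq = begin
    f y                        ≈⟨ eq y ⟩
    f (r 0) + (y - r 0) * g y  ≈⟨ +-cong (root ℕ.z≤n) (*-congˡ (Poly-roots d (r ∘ suc) Pg
                                    (λ i<k k≤d → distinct (ℕ.s<s i<k) (ℕ.s≤s k≤d)) g-root y)) ⟩
    0# + (y - r 0) * 0#        ≈⟨ trans (+-identityˡ _) (zeroʳ _) ⟩
    0#                         ∎
    where
    g-root : ∀ {i} → i ℕ.≤ d → g (r (suc i)) ≈ 0#
    g-root {i} i≤d = cancelˡ (λ r-r≈0 → distinct ℕ.z<s (ℕ.s≤s i≤d) (difference≈0 r-r≈0)) (begin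
      (r (suc i) - r 0) * g (r (suc i))             ≈⟨ +-identityˡ _ ⟨
      0# + (r (suc i) - r 0) * g (r (suc i))        ≈⟨ +-congʳ (root ℕ.z≤n) ⟨
      f (r 0) + (r (suc i) - r 0) * g (r (suc i))   ≈⟨ eq (r (suc i)) ⟨
      f (r (suc i))                                 ≈⟨ root (ℕ.s≤s i≤d) ⟩
      0#                                            ∎)

  ∏-vanishes : ∀ n {f} i → i ℕ.< n → f i ≈ 0# → ∏ n f ≈ 0#
  ∏-vanishes (suc n) zero    i<n fi≈0 = trans (*-congʳ fi≈0) (zeroˡ _)
  ∏-vanishes (suc n) (suc i) i<n fi≈0 = trans (*-congˡ (∏-vanishes n i (ℕ.s<s⁻¹ i<n) fi≈0)) (zeroʳ _)

  ι-≡ : ∀ {i j} → i ≡ j → ι i ≈ ι j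
  ι-≡ = reflexive ∘ cong ι

  E-≡ : ∀ {s t} → s ≡ t → E s ≈ E t
  E-≡ = reflexive ∘ cong E

  E-0 : E (+ 0) ≈ 1#
  E-0 = ∣⇒E≈1 (divides (+ 0) ≡.refl)

  E-inverse : ∀ t → E (ℤ.- t) * E t ≈ 1#
  E-inverse t = trans (sym (E-+ (ℤ.- t) t)) (trans (E-≡ (ℤ.+-inverseˡ t)) E-0)

  E≉0 : ∀ t → E t ≉ 0#
  E≉0 t Et≈0 = 1≉0 (trans (sym (E-inverse t)) (trans (*-congˡ Et≈0) (zeroʳ _)))

  E-periodic : ∀ {s t} → + N ∣ s ℤ.- t → E s ≈ E t
  E-periodic {s} {t} N∣s-t = begin
    E s                    ≈⟨ E-≡ (split s t) ⟩
    E ((s ℤ.- t) ℤ.+ t)    ≈⟨ E-+ (s ℤ.- t) t ⟩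
    E (s ℤ.- t) * E t      ≈⟨ *-congʳ (∣⇒E≈1 N∣s-t) ⟩
    1# * E t               ≈⟨ *-identityˡ (E t) ⟩
    E t                    ∎
    where
    split : ∀ s t → s ≡ (s ℤ.- t) ℤ.+ t
    split = solve-∀

  E-injective : ∀ {s t} → E s ≈ E t → + N ∣ s ℤ.- t
  E-injective {s} {t} Es≈Et = E≈1⇒∣ (begin
    E (s ℤ.- t)          ≈⟨ E-+ s (ℤ.- t) ⟩
    E s * E (ℤ.- t)      ≈⟨ *-congʳ Es≈Et ⟩
    E t * E (ℤ.- t)      ≈⟨ *-comm _ _ ⟩
    E (ℤ.- t) * E t      ≈⟨ E-inverse t ⟩
    1#                   ∎)

  E-^ : ∀ t i → E (t ℤ.* + i) ≈ E t ^ i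
  E-^ t zero    = trans (E-≡ (ℤ.*-zeroʳ t)) E-0
  E-^ t (suc i) = begin
    E (t ℤ.* (+ 1 ℤ.+ + i))    ≈⟨ E-≡ (expand t (+ i)) ⟩
    E (t ℤ.+ t ℤ.* + i)        ≈⟨ E-+ t _ ⟩
    E t * E (t ℤ.* + i)        ≈⟨ *-congˡ (E-^ t i) ⟩
    E t * E t ^ i              ∎
    where
    expand : ∀ t i → t ℤ.* (+ 1 ℤ.+ i) ≡ t ℤ.+ t ℤ.* i
    expand = solve-∀

  geometric-zero : ∀ n {z} → z ≉ 1# → z ^ n ≈ 1# → ∑ n (λ i → z ^ i) ≈ 0#
  geometric-zero n {z} z≉1 zⁿ≈1 = cancelˡ (λ 1-z≈0 → z≉1 (sym (difference≈0 1-z≈0)))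
    (trans (geometric n z) (≈⇒difference≈0 (sym zⁿ≈1)))

  ∑-ones : ∀ n → ∑ n (λ _ → 1#) ≈ ι (+ n)
  ∑-ones zero    = sym ι-0
  ∑-ones (suc n) = trans (+-cong (sym ι-1) (∑-ones n)) (sym (ι-+ (+ 1) (+ n)))

  Poly-∏ : ∀ n (c : ℕ → Carrier) → ∃ λ ℓ → Poly n ℓ (λ z → ∏ n (λ t → 1# - z * c t))
  Poly-∏ zero    c = 1# , constant λ _ → refl
  Poly-∏ (suc n) c with Poly-∏ n (c ∘ suc)
  ... | ℓ , P = _ , Poly-cong refl
    (λ z → *-congʳ (+-congˡ (solve 2 (λ c z → :- c :* z := :- (z :* c)) refl (c 0) z)))
    (Poly-linear* 1# (- c 0) P)

  Poly-∑^ : ∀ n → ∃ λ ℓ → Poly n ℓ (λ z → ∑ (suc n) (λ i → z ^ i))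
  Poly-∑^ zero    = 1# , constant λ _ → +-identityʳ 1#
  Poly-∑^ (suc n) with Poly-∑^ n
  ... | ℓ , P = ℓ , horner 1# _ P λ z → +-congˡ (∑-scale (suc n) z (z ^_))

  -- The (h+1)-th roots of unity other than 1 are the roots of 1 + z + ... + z^h, up to inversion.
  ∏-nontrivial-roots : ∀ n h → n ℕ.* suc h ≡ N → .{{_ : ℕ.NonZero N}} → ∀ z →
    ∏ h (λ t → 1# - z * E (+ n ℤ.* + suc t)) ≈ ∑ (suc h) (λ i → z ^ i)
  ∏-nontrivial-roots n h nh≡N z = difference≈0 (trans (+-congˡ (sym (-1*x≈-x _))) (Poly-roots h root
    (Poly-+ (proj₂ (Poly-∏ h _)) (Poly-scale (- 1#) (proj₂ (Poly-∑^ h)))) distinct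
    (λ {i} i≤h → trans (+-congˡ (-1*x≈-x _))
                       (≈⇒difference≈0 (agree i i≤h))) z))
    where
    instance
      n≢0 : ℕ.NonZero n
      n≢0 = ℕ.≢-nonZero λ { ≡.refl → ℕ.≢-nonZero⁻¹ N (≡.sym nh≡N) }

    ∣⇒∣′ : ∀ {i} → + N ∣ + n ℤ.* i → + suc h ∣ i
    ∣⇒∣′ N∣ni = *-cancelˡ-∣ (+ n) (subst (_∣ _) (≡.trans (cong +_ (≡.sym nh≡N)) (ℤ.pos-* n (suc h))) N∣ni)

    -- Both sides have degree at most h in z, so they must agree at h + 1 points. At the h inverse
    -- roots both are 0; the missing point is z = 0, where both are 1.
    root : ℕ → Carrier
    root zero    = 0#
    root (suc i) = E (ℤ.- (+ n ℤ.* + suc i))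

    distinct : ∀ {i k} → i ℕ.< k → k ℕ.≤ h → root k ≉ root i
    distinct {zero}  {suc k} i<k k≤h e = E≉0 _ e
    distinct {suc i} {suc k} i<k k≤h e = ℕ.<⇒≢ i<k (≡.sym (residue-unique (ℕ.s≤s k≤h) (ℕ.<-trans i<k (ℕ.s≤s k≤h))
      (∣⇒∣′ (subst (+ N ∣_) (factor (+ n) (+ suc i) (+ suc k)) (E-injective (sym e))))))
      where
      factor : ∀ n i k → ℤ.- (n ℤ.* i) ℤ.- ℤ.- (n ℤ.* k) ≡ n ℤ.* (k ℤ.- i)
      factor = solve-∀

    agree : ∀ i → i ℕ.≤ h → ∏ h (λ t → 1# - root i * E (+ n ℤ.* + suc t)) ≈ ∑ (suc h) (λ k → root i ^ k)
    agree zero i≤h = trans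
      (∏-one h λ t _ → trans (+-congˡ (-‿cong (zeroˡ _))) (trans (+-congˡ -0#≈0#) (+-identityʳ 1#)))
      (sym (trans (+-congˡ (∑-zero h λ t _ → zeroˡ _)) (+-identityʳ 1#)))
    agree (suc i) i<h = trans
      (∏-vanishes h i i<h (≈⇒difference≈0 (sym (E-inverse _))))
      (sym (geometric-zero (suc h)
        (λ e → ℕ.1+n≢0 (m∣n∧n<m⇒n≡0 (∣⇒∣ᵤ (∣⇒∣′ (subst (+ N ∣_) (ℤ.neg-involutive _) (∣m⇒∣-m (E≈1⇒∣ e))))) (ℕ.s≤s i<h)))
        (trans (sym (E-^ _ (suc h))) (∣⇒E≈1 (divides (ℤ.- + suc i)
          (≡.trans (swap (+ n) (+ suc i) (+ suc h)) (cong (ℤ.- + suc i ℤ.*_) (≡.trans (≡.sym (ℤ.pos-* n (suc h))) (cong +_ nh≡N)))))))))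
      where
      swap : ∀ n i h → ℤ.- (n ℤ.* i) ℤ.* h ≡ ℤ.- i ℤ.* (n ℤ.* h)
      swap = solve-∀

-- The covering function at a single class, divisibility after scaling, and subset sums.

module _ {k : ℕ} (a : Fin (suc k) → ℤ) (n : Fin (suc k) → ℕ) {x : ℤ} where
  w-hit : + n zero ∣ x ℤ.- a zero → w a n x ≡ suc (w (a ∘ suc) (n ∘ suc) x)
  w-hit n∣ = cong (λ b → (if b then 1 else 0) ℕ.+ w (a ∘ suc) (n ∘ suc) x) (dec-true (+ n zero ∣? x ℤ.- a zero) n∣)

  w-miss : ¬ (+ n zero ∣ x ℤ.- a zero) → w a n x ≡ w (a ∘ suc) (n ∘ suc) x
  w-miss n∤ = cong (λ b → (if b then 1 else 0) ℕ.+ w (a ∘ suc) (n ∘ suc) x) (dec-false (+ n zero ∣? x ℤ.- a zero) n∤)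

module _ {n h N : ℕ} (nh≡N : n ℕ.* h ≡ N) where
  scale-∣ : ∀ {s} → + n ∣ s → + N ∣ s ℤ.* + h
  scale-∣ {s} n∣s = subst (_∣ s ℤ.* + h) (≡.trans (≡.sym (ℤ.pos-* n h)) (cong +_ nh≡N)) (*-monoˡ-∣ (+ h) n∣s)

  unscale-∣ : .{{_ : ℕ.NonZero N}} → ∀ {s} → + N ∣ s ℤ.* + h → + n ∣ s
  unscale-∣ N∣sh = *-cancelʳ-∣ (+ h) {{ℕ.≢-nonZero λ { ≡.refl → ℕ.≢-nonZero⁻¹ N (≡.trans (≡.sym nh≡N) (ℕ.*-zeroʳ n)) }}}
    (subst (_∣ _) (≡.trans (cong +_ (≡.sym nh≡N)) (ℤ.pos-* n h)) N∣sh)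

-- For `h s` = N/n_s this is N times the sum of 1/n_s over I: the numerator over the common
-- denominator N, and the exponent of z belonging to I.
subsetSum : ∀ {j} → (Fin j → ℕ) → Subset j → ℕ
subsetSum h []      = 0
subsetSum h (b ∷ I) = (if b then h zero else 0) ℕ.+ subsetSum (h ∘ suc) I

periodic⇒∣ : (g : ℤ → ℕ) (n : ℕ) → (∀ x → g (x ℤ.+ + n) ≡ g x) → ∀ {x y} → + n ∣ x ℤ.- y → g x ≡ g y
periodic⇒∣ g n periodic {x} {y} (divides q x-y≡qn) = from-quotient q x-y≡qn
  where
  multiples : ∀ k x → g (x ℤ.+ + k ℤ.* + n) ≡ g x
  multiples zero    x = cong g (≡.trans (cong (λ z → x ℤ.+ z) (ℤ.*-zeroˡ (+ n))) (ℤ.+-identityʳ x))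
  multiples (suc k) x = ≡.trans (cong g (expand x (+ k) (+ n))) (≡.trans (periodic _) (multiples k x))
    where
    expand : ∀ x k n → x ℤ.+ (+ 1 ℤ.+ k) ℤ.* n ≡ (x ℤ.+ k ℤ.* n) ℤ.+ n
    expand = solve-∀
  recover : ∀ x y → y ℤ.+ (x ℤ.- y) ≡ x
  recover = solve-∀
  from-quotient : ∀ q → x ℤ.- y ≡ q ℤ.* + n → g x ≡ g y
  from-quotient (+ k)        eq = ≡.trans (cong g (≡.trans (≡.sym (recover x y)) (cong (λ z → y ℤ.+ z) eq))) (multiples k y)
  from-quotient ℤ.-[1+ k ]   eq = ≡.sym (≡.trans (cong g (≡.trans (≡.sym (i-[i-j]≡j x y))
    (cong (λ z → x ℤ.+ z) (≡.trans (cong ℤ.-_ eq) (ℤ.neg-distribˡ-* ℤ.-[1+ k ] (+ n)))))) (multiples (suc k) x))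

-- Leading coefficients and differential operators at roots of unity.

module CoverSums {N : ℕ} .{{N≢0 : ℕ.NonZero N}} (D : CyclotomicDomain N) where
  open Cyclotomic D
  open import Algebra.Properties.Ring ring using (-0#≈0#; -‿distribˡ-*)
  open import Relation.Binary.Reasoning.Setoid setoid

  -- The vanishing factor 1 - E 0 is replaced by 1, so that it drops out of products.
  rootFactor : ℕ → Carrier
  rootFactor zero    = 1#
  rootFactor (suc u) = 1# - E (+ suc u)

  rootFactor-≢0 : ∀ {u} → u ≢ 0 → rootFactor u ≈ 1# - E (+ u)
  rootFactor-≢0 {zero}  u≢0 = ⊥-elim (u≢0 ≡.refl)
  rootFactor-≢0 {suc u} u≢0 = refl

  -- The value at z = 1 of 1 - E (y h) z^h, or of (1 - z^h) / (1 - z) if E (y h) = 1.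
  localFactor : ℕ → ℕ → ℤ → Carrier
  localFactor n h y = if does (+ n ∣? y) then ι (+ h) else 1# - E (y ℤ.* + h)

  localFactor-hit : ∀ {n h y} → + n ∣ y → localFactor n h y ≡ ι (+ h)
  localFactor-hit {n} {h} {y} n∣y = cong (if_then ι (+ h) else 1# - E (y ℤ.* + h)) (dec-true (+ n ∣? y) n∣y)

  localFactor-miss : ∀ {n h y} → ¬ (+ n ∣ y) → localFactor n h y ≡ 1# - E (y ℤ.* + h)
  localFactor-miss {n} {h} {y} n∤y = cong (if_then ι (+ h) else 1# - E (y ℤ.* + h)) (dec-false (+ n ∣? y) n∤y)

  -- Let r be the residue of y modulo n. The numbers u < N congruent to y are r + t n with t < h,
  -- and the E (t n) are all the h-th roots of unity, so the factors 1 - E u multiply to 1 - E (r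
  -- h). For r = 0 the factor at t = 0 is replaced by 1, and the others multiply to 1 + ... + 1 = h.
  localFactor-∏ : ∀ n h → n ℕ.* h ≡ N → ∀ y →
    localFactor n h y ≈ ∏ N (λ u → if does (+ n ∣? y ℤ.- + u) then rootFactor u else 1#)
  localFactor-∏ n zero nh≡N y = ⊥-elim (ℕ.≢-nonZero⁻¹ N (≡.trans (≡.sym nh≡N) (ℕ.*-zeroʳ n)))
  localFactor-∏ zero (suc h) nh≡N y = ⊥-elim (ℕ.≢-nonZero⁻¹ N (≡.sym nh≡N))
  localFactor-∏ n@(suc _) (suc h) nh≡N y = begin
    localFactor n (suc h) y                                     ≈⟨ split (+ n ∣? y) ⟩
    ∏ (suc h) (λ t → rootFactor (t ℕ.* n ℕ.+ r))                ≈⟨ ∏-residue (suc h) n y rootFactor ⟨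
    ∏ (suc h ℕ.* n) F                                           ≡⟨ cong (λ m → ∏ m F) (≡.trans (ℕ.*-comm (suc h) n) nh≡N) ⟩
    ∏ N F                                                       ∎
    where
    r = y %ℕ n
    F : ℕ → Carrier
    F u = if does (+ n ∣? y ℤ.- + u) then rootFactor u else 1#

    n∣y-r : + n ∣ y ℤ.- + r
    n∣y-r = residue-∣ n y 0

    E-term : ∀ t → E (+ (t ℕ.* n ℕ.+ r)) ≈ E (+ r) * E (+ n ℤ.* + t)
    E-term t = trans (E-≡ (≡.trans (ℤ.pos-+ (t ℕ.* n) r) (≡.trans (cong (ℤ._+ + r) (ℤ.pos-* t n)) (swap (+ t) (+ n) (+ r)))))
                     (E-+ (+ r) (+ n ℤ.* + t))
      where
      swap : ∀ t n r → t ℤ.* n ℤ.+ r ≡ r ℤ.+ n ℤ.* t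
      swap = solve-∀

    factor : ∀ t → t ℕ.* n ℕ.+ r ≢ 0 → rootFactor (t ℕ.* n ℕ.+ r) ≈ 1# - E (+ r) * E (+ n ℤ.* + t)
    factor t ≢0 = trans (rootFactor-≢0 ≢0) (+-congˡ (-‿cong (E-term t)))

    tail≈∑ : ∏ h (λ t → rootFactor (suc t ℕ.* n ℕ.+ r)) ≈ ∑ (suc h) (λ i → E (+ r) ^ i)
    tail≈∑ = trans (∏-cong h λ t → factor (suc t) λ ()) (∏-nontrivial-roots n h nh≡N (E (+ r)))

    split : _ → localFactor n (suc h) y ≈ ∏ (suc h) (λ t → rootFactor (t ℕ.* n ℕ.+ r))
    split (yes n∣y) = begin
      localFactor n (suc h) y                                               ≡⟨ localFactor-hit n∣y ⟩
      ι (+ suc h)                                                           ≈⟨ ∑-ones (suc h) ⟨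
      ∑ (suc h) (λ _ → 1#)                                                  ≈⟨ ∑-cong (suc h) (λ i → 1^ i) ⟨
      ∑ (suc h) (λ i → 1# ^ i)                                              ≈⟨ ∑-cong (suc h) (λ i → ^-congˡ i E-0) ⟨
      ∑ (suc h) (λ i → E (+ 0) ^ i)                                         ≡⟨ cong (λ r → ∑ (suc h) (λ i → E (+ r) ^ i)) r≡0 ⟨
      ∑ (suc h) (λ i → E (+ r) ^ i)                                         ≈⟨ tail≈∑ ⟨
      ∏ h (λ t → rootFactor (suc t ℕ.* n ℕ.+ r))                            ≈⟨ *-identityˡ _ ⟨
      1# * ∏ h (λ t → rootFactor (suc t ℕ.* n ℕ.+ r))                       ≡⟨ cong (λ r′ → rootFactor r′ * ∏ h (λ t → rootFactor (suc t ℕ.* n ℕ.+ r))) r≡0 ⟨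
      ∏ (suc h) (λ t → rootFactor (t ℕ.* n ℕ.+ r))                          ∎
      where
      r≡0 : r ≡ 0
      r≡0 = m∣n∧n<m⇒n≡0 (∣⇒∣ᵤ (subst (+ n ∣_) (i-[i-j]≡j y (+ r)) (∣m∣n⇒∣m-n n∣y n∣y-r))) (n%ℕd<d y n)
    split (no n∤y) = begin
      localFactor n (suc h) y                                               ≡⟨ localFactor-miss n∤y ⟩
      1# - E (y ℤ.* + suc h)                                                ≈⟨ +-congˡ (-‿cong (E-periodic (subst (+ N ∣_) (expand y (+ r) (+ suc h)) (scale-∣ nh≡N n∣y-r)))) ⟩
      1# - E (+ r ℤ.* + suc h)                                              ≈⟨ +-congˡ (-‿cong (E-^ (+ r) (suc h))) ⟩
      1# - E (+ r) ^ suc h                                                  ≈⟨ geometric (suc h) (E (+ r)) ⟨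
      (1# - E (+ r)) * ∑ (suc h) (λ i → E (+ r) ^ i)                        ≈⟨ *-cong (sym (rootFactor-≢0 r≢0)) (sym tail≈∑) ⟩
      ∏ (suc h) (λ t → rootFactor (t ℕ.* n ℕ.+ r))                          ∎
      where
      r≢0 : r ≢ 0
      r≢0 r≡0 = n∤y (subst (+ n ∣_) (≡.trans (cong (λ r → y ℤ.- + r) r≡0) (ℤ.+-identityʳ y)) n∣y-r)
      expand : ∀ y r h → (y ℤ.- r) ℤ.* h ≡ y ℤ.* h ℤ.- r ℤ.* h
      expand = solve-∀

  localFactor≉0 : ∀ {n h y} → n ℕ.* h ≡ N → ι (+ h) ≉ 0# → localFactor n h y ≉ 0#
  localFactor≉0 {n} {h} {y} nh≡N h≉0 with + n ∣? y
  ... | yes n∣y = λ e → h≉0 (trans (reflexive (≡.sym (localFactor-hit {n} {h} n∣y))) e)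
  ... | no n∤y = λ e → n∤y (unscale-∣ {n} {h} nh≡N (E≈1⇒∣ (sym (difference≈0
    (trans (reflexive (≡.sym (localFactor-miss {n} {h} n∤y))) e)))))

  -- When n_s h_s = N for all s, this is the value at z = 1 of the product of the 1 - E ((x - a_s)
  -- h_s) z^(h_s) after division by (1 - z)^w(x): each class containing x gives up one factor 1 - z.
  leading : ∀ {j} → (Fin j → ℤ) → (Fin j → ℕ) → (Fin j → ℕ) → ℤ → Carrier
  leading {zero}  a n h x = 1#
  leading {suc j} a n h x =
    localFactor (n zero) (h zero) (x ℤ.- a zero) * leading (a ∘ suc) (n ∘ suc) (h ∘ suc) x

  -- The right-hand side involves a and n only through w, so periodicity of w passes to it.
  leading-∏ : ∀ {j} (a : Fin j → ℤ) n h → (∀ s → n s ℕ.* h s ≡ N) → ∀ x →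
    leading a n h x ≈ ∏ N (λ u → rootFactor u ^ w a n (x ℤ.- + u))
  leading-∏ {zero}  a n h nh≡N x = sym (∏-one N λ _ _ → refl)
  leading-∏ {suc j} a n h nh≡N x = begin
    localFactor (n zero) (h zero) (x ℤ.- a zero) * leading (a ∘ suc) (n ∘ suc) (h ∘ suc) x
      ≈⟨ *-cong (localFactor-∏ (n zero) (h zero) (nh≡N zero) (x ℤ.- a zero)) (leading-∏ (a ∘ suc) (n ∘ suc) (h ∘ suc) (nh≡N ∘ suc) x) ⟩
    ∏ N (λ u → if does (+ n zero ∣? x ℤ.- a zero ℤ.- + u) then rootFactor u else 1#)
      * ∏ N (λ u → rootFactor u ^ w (a ∘ suc) (n ∘ suc) (x ℤ.- + u))
      ≈⟨ ∏-* N _ _ ⟨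
    ∏ N (λ u → (if does (+ n zero ∣? x ℤ.- a zero ℤ.- + u) then rootFactor u else 1#)
      * rootFactor u ^ w (a ∘ suc) (n ∘ suc) (x ℤ.- + u))
      ≈⟨ ∏-cong N (λ u → trans (reflexive (cong (λ y → (if does (+ n zero ∣? y) then rootFactor u else 1#) * rootFactor u ^ w (a ∘ suc) (n ∘ suc) (x ℤ.- + u))
                                                 (swap x (a zero) (+ u))))
                               (merge u (does (+ n zero ∣? x ℤ.- + u ℤ.- a zero)) {w (a ∘ suc) (n ∘ suc) (x ℤ.- + u)})) ⟩
    ∏ N (λ u → rootFactor u ^ w a n (x ℤ.- + u))  ∎
    where
    swap : ∀ x a u → x ℤ.- a ℤ.- u ≡ x ℤ.- u ℤ.- a
    swap = solve-∀
    merge : ∀ u b {k} → (if b then rootFactor u else 1#) * rootFactor u ^ k ≈ rootFactor u ^ ((if b then 1 else 0) ℕ.+ k)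
    merge u true  = refl
    merge u false = *-identityˡ _

  leading≉0 : ∀ {j} (a : Fin j → ℤ) n h → (∀ s → n s ℕ.* h s ≡ N) → (∀ s → ι (+ h s) ≉ 0#) → ∀ x →
    leading a n h x ≉ 0#
  leading≉0 {zero}  a n h nh≡N h≉0 x = 1≉0
  leading≉0 {suc j} a n h nh≡N h≉0 x = *-≉0 (localFactor≉0 {n zero} {h zero} {x ℤ.- a zero} (nh≡N zero) (h≉0 zero))
    (leading≉0 (a ∘ suc) (n ∘ suc) (h ∘ suc) (nh≡N ∘ suc) (h≉0 ∘ suc) x)

  -- The sum over I of (-1)^|I| ∏_{s ∈ I} η s · f (- ∑_{s ∈ I} h s); this is f (- z d/dz) applied to
  -- ∏_s (1 - η s z^(h s)) at z = 1.
  signedSum : ∀ {j} → (Fin j → Carrier) → (Fin j → ℕ) → (Carrier → Carrier) → Carrier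
  signedSum {zero}  η h f = f 0#
  signedSum {suc j} η h f =
    signedSum (η ∘ suc) (h ∘ suc) f - η zero * signedSum (η ∘ suc) (h ∘ suc) (λ y → f (y - ι (+ h zero)))

  signedSum-cong : ∀ {j} (η : Fin j → Carrier) h {f g} → (∀ y → f y ≈ g y) → signedSum η h f ≈ signedSum η h g
  signedSum-cong {zero}  η h f≈g = f≈g 0#
  signedSum-cong {suc j} η h f≈g = sub-cong (signedSum-cong (η ∘ suc) (h ∘ suc) f≈g)
    (*-congˡ (signedSum-cong (η ∘ suc) (h ∘ suc) λ y → f≈g (y - ι (+ h zero))))

  signedSum-zero : ∀ {j} (η : Fin j → Carrier) h {f} → (∀ y → f y ≈ 0#) → signedSum η h f ≈ 0#
  signedSum-zero {zero}  η h f≈0 = f≈0 0#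
  signedSum-zero {suc j} η h f≈0 = trans (sub-cong (signedSum-zero (η ∘ suc) (h ∘ suc) f≈0)
    (trans (*-congˡ (signedSum-zero (η ∘ suc) (h ∘ suc) λ y → f≈0 (y - ι (+ h zero)))) (zeroʳ _))) (-‿inverseʳ 0#)

  signedSum-linear : ∀ {j} (η : Fin j → Carrier) h c f g →
    signedSum η h (λ y → f y - c * g y) ≈ signedSum η h f - c * signedSum η h g
  signedSum-linear {zero}  η h c f g = refl
  signedSum-linear {suc j} η h c f g = trans
    (sub-cong (signedSum-linear (η ∘ suc) (h ∘ suc) c f g) (*-congˡ (signedSum-linear (η ∘ suc) (h ∘ suc) c _ _)))
    (solve 6 (λ e c a b u v → a :- c :* b :- e :* (u :- c :* v) := a :- e :* u :- c :* (b :- e :* v)) refl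
      (η zero) c _ _ _ _)

  -- Substituting E x times z for z moves the point E x to 1 and turns the coefficients E (-a_s h_s)
  -- into these. Hence every evaluation can take place at z = 1.
  character : ∀ {j} → (Fin j → ℤ) → (Fin j → ℕ) → ℤ → Fin j → Carrier
  character a h x s = E ((x ℤ.- a s) ℤ.* + h s)

  module _ {j} (a : Fin (suc j) → ℤ) (n h : Fin (suc j) → ℕ) (nh≡N : ∀ s → n s ℕ.* h s ≡ N) (x : ℤ) where
    private
      η = character a h x zero
      S = signedSum (character (a ∘ suc) (h ∘ suc) x) (h ∘ suc)

    -- A class containing x has η = 1, so its factor acts on f as a backward difference, which
    -- lowers the degree.
    signedSum-hit : + n zero ∣ x ℤ.- a zero → ∀ f →
      signedSum (character a h x) h f ≈ S (λ y → f y - f (y - ι (+ h zero)))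
    signedSum-hit n∣ f = trans (sym (signedSum-linear (character (a ∘ suc) (h ∘ suc) x) (h ∘ suc) η f _))
      (signedSum-cong (character (a ∘ suc) (h ∘ suc) x) (h ∘ suc)
        λ y → +-congˡ (-‿cong (trans (*-congʳ (∣⇒E≈1 (scale-∣ (nh≡N zero) n∣))) (*-identityˡ _))))

    signedSum-miss : ∀ f → signedSum (character a h x) h f ≈ S (λ y → f y - η * f (y - ι (+ h zero)))
    signedSum-miss f = sym (signedSum-linear (character (a ∘ suc) (h ∘ suc) x) (h ∘ suc) η f _)

    leading-hit : + n zero ∣ x ℤ.- a zero →
      leading a n h x ≈ ι (+ h zero) * leading (a ∘ suc) (n ∘ suc) (h ∘ suc) x
    leading-hit n∣ = *-congʳ (reflexive (localFactor-hit {n zero} {h zero} n∣))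

    leading-miss : ¬ (+ n zero ∣ x ℤ.- a zero) →
      leading a n h x ≈ (1# - η) * leading (a ∘ suc) (n ∘ suc) (h ∘ suc) x
    leading-miss n∤ = *-congʳ (reflexive (localFactor-miss {n zero} {h zero} n∤))

    -- A class that misses x keeps the degree bound and contributes to the leading coefficient the
    -- same factor 1 - η as in `leading-miss`.
    Poly-twist : ∀ {d ℓ f} → Poly d ℓ f → Poly d ((1# - η) * ℓ) (λ y → f y - η * f (y - ι (+ h zero)))
    Poly-twist {ℓ = ℓ} P = Poly-cong (trans (+-congʳ (sym (*-identityˡ ℓ)))
        (solve 3 (λ i e ℓ → i :* ℓ :+ :- e :* ℓ := (i :- e) :* ℓ) refl 1# η ℓ))
      (λ y → +-congˡ (sym (-‿distribˡ-* _ _)))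
      (Poly-+ P (Poly-scale (- η) (Poly-shift (ι (+ h zero)) P)))

  -- Every class containing x takes one difference of f. After d of them a constant is left, and the
  -- next one makes it 0.
  signedSum-vanishes : ∀ {j} (a : Fin j → ℤ) n h → (∀ s → n s ℕ.* h s ≡ N) → ∀ x {d ℓ f} → Poly d ℓ f →
    d ℕ.< w a n x → signedSum (character a h x) h f ≈ 0#
  signedSum-vanishes {zero}  a n h nh≡N x P ()
  signedSum-vanishes {suc j} a n h nh≡N x {f = f} P d<w with + n zero ∣? x ℤ.- a zero
  signedSum-vanishes {suc j} a n h nh≡N x {f = f} (constant P) d<w | yes n∣ =
    trans (signedSum-hit a n h nh≡N x n∣ f) (signedSum-zero (character (a ∘ suc) (h ∘ suc) x) (h ∘ suc)
      λ y → ≈⇒difference≈0 (trans (P y) (sym (P _))))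
  signedSum-vanishes {suc j} a n h nh≡N x {suc d} {f = f} P@(horner _ _ _ _) d<w | yes n∣ =
    trans (signedSum-hit a n h nh≡N x n∣ f) (signedSum-vanishes (a ∘ suc) (n ∘ suc) (h ∘ suc) (nh≡N ∘ suc) x
      (Poly-difference (ι (+ h zero)) P) (ℕ.s<s⁻¹ (subst (suc d ℕ.<_) (w-hit a n n∣) d<w)))
  signedSum-vanishes {suc j} a n h nh≡N x {d} {f = f} P d<w | no n∤ =
    trans (signedSum-miss a n h nh≡N x f) (signedSum-vanishes (a ∘ suc) (n ∘ suc) (h ∘ suc) (nh≡N ∘ suc) x
      (Poly-twist a n h nh≡N x P) (subst (d ℕ.<_) (w-miss a n n∤) d<w))

  -- Exactly d differences are taken, so f ends as a constant. The degrees passed on the way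
  -- multiply to d!, while the steps h of the differences and the factors 1 - η of the other classes
  -- multiply to `leading`.
  signedSum-leading : ∀ {j} (a : Fin j → ℤ) n h → (∀ s → n s ℕ.* h s ≡ N) → ∀ x {d ℓ f} → Poly d ℓ f →
    w a n x ≡ d → signedSum (character a h x) h f ≈ ι (+ (d !)) * ℓ * leading a n h x
  signedSum-leading {zero}  a n h nh≡N x (constant {ℓ} P) ≡.refl =
    trans (P 0#) (sym (trans (*-identityʳ _) (trans (*-congʳ ι-1) (*-identityˡ ℓ))))
  signedSum-leading {suc j} a n h nh≡N x {f = f} P w≡d with + n zero ∣? x ℤ.- a zero
  signedSum-leading {suc j} a n h nh≡N x {f = f} (constant P) w≡d | yes n∣ with () ← ≡.trans (≡.sym (w-hit a n n∣)) w≡d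
  signedSum-leading {suc j} a n h nh≡N x {suc d} {ℓ} {f} P@(horner _ _ _ _) w≡d | yes n∣ = begin
    signedSum (character a h x) h f
      ≈⟨ signedSum-hit a n h nh≡N x n∣ f ⟩
    signedSum (character (a ∘ suc) (h ∘ suc) x) (h ∘ suc) (λ y → f y - f (y - ι (+ h zero)))
      ≈⟨ signedSum-leading (a ∘ suc) (n ∘ suc) (h ∘ suc) (nh≡N ∘ suc) x (Poly-difference (ι (+ h zero)) P)
           (ℕ.suc-injective (≡.trans (≡.sym (w-hit a n n∣)) w≡d)) ⟩
    ι (+ (d !)) * (ι (+ suc d) * ι (+ h zero) * ℓ) * leading (a ∘ suc) (n ∘ suc) (h ∘ suc) x
      ≈⟨ solve 5 (λ e d h ℓ L → e :* (d :* h :* ℓ) :* L := d :* e :* ℓ :* (h :* L)) refl _ _ _ ℓ _ ⟩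
    ι (+ suc d) * ι (+ (d !)) * ℓ * (ι (+ h zero) * leading (a ∘ suc) (n ∘ suc) (h ∘ suc) x)
      ≈⟨ *-cong (*-congʳ (trans (sym (ι-* (+ suc d) (+ (d !)))) (ι-≡ (≡.sym (ℤ.pos-* (suc d) (d !))))))
                (sym (leading-hit a n h nh≡N x n∣)) ⟩
    ι (+ (suc d !)) * ℓ * leading a n h x ∎
  signedSum-leading {suc j} a n h nh≡N x {d} {ℓ} {f} P w≡d | no n∤ = begin
    signedSum (character a h x) h f
      ≈⟨ signedSum-miss a n h nh≡N x f ⟩
    signedSum (character (a ∘ suc) (h ∘ suc) x) (h ∘ suc) (λ y → f y - character a h x zero * f (y - ι (+ h zero)))
      ≈⟨ signedSum-leading (a ∘ suc) (n ∘ suc) (h ∘ suc) (nh≡N ∘ suc) x (Poly-twist a n h nh≡N x P)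
           (≡.trans (≡.sym (w-miss a n n∤)) w≡d) ⟩
    ι (+ (d !)) * ((1# - character a h x zero) * ℓ) * leading (a ∘ suc) (n ∘ suc) (h ∘ suc) x
      ≈⟨ solve 4 (λ e t ℓ L → e :* (t :* ℓ) :* L := e :* ℓ :* (t :* L)) refl _ _ ℓ _ ⟩
    ι (+ (d !)) * ℓ * ((1# - character a h x zero) * leading (a ∘ suc) (n ∘ suc) (h ∘ suc) x)
      ≈⟨ *-congˡ (leading-miss a n h nh≡N x n∤) ⟨
    ι (+ (d !)) * ℓ * leading a n h x ∎

  monomial : ∀ {j} → (Fin j → Carrier) → Subset j → Carrier
  monomial η []      = 1#
  monomial η (b ∷ I) = (if b then η zero else 1#) * monomial (η ∘ suc) I

  -- The point at which `signedSum` evaluates f in the term of I. The subtractions are nested as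
  -- they are there, so that the terms match by computation.
  node : ∀ {j} → (Fin j → ℕ) → Subset j → Carrier
  node h []      = 0#
  node h (b ∷ I) = if b then node (h ∘ suc) I - ι (+ h zero) else node (h ∘ suc) I

  -- Exchanging the sums over i and I leaves, for each I, a character sum times one value of f. In
  -- the induction the weights c absorb the η of the first class when it belongs to I, which is why
  -- c is arbitrary.
  ∑-signedSum-zero : ∀ {j} M (η : ℕ → Fin j → Carrier) (h : Fin j → ℕ) (c : ℕ → Carrier) (f : Carrier → Carrier) →
    (∀ I → ∑ M (λ i → c i * monomial (η i) I) * f (node h I) ≈ 0#) →
    ∑ M (λ i → c i * signedSum (η i) h f) ≈ 0#
  ∑-signedSum-zero {zero}  M η h c f zeros = begin
    ∑ M (λ i → c i * f 0#)          ≈⟨ ∑-cong M (λ i → trans (*-congʳ (sym (*-identityʳ (c i)))) (*-comm _ _)) ⟩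
    ∑ M (λ i → f 0# * (c i * 1#))   ≈⟨ ∑-scale M (f 0#) (λ i → c i * 1#) ⟩
    f 0# * ∑ M (λ i → c i * 1#)     ≈⟨ *-comm _ _ ⟩
    ∑ M (λ i → c i * 1#) * f 0#     ≈⟨ zeros [] ⟩
    0#                              ∎
  ∑-signedSum-zero {suc j} M η h c f zeros = begin
    ∑ M (λ i → c i * (A i - η i zero * B i))               ≈⟨ ∑-cong M (λ i → distribute (c i) (A i) (η i zero) (B i)) ⟩
    ∑ M (λ i → c i * A i - c i * η i zero * B i)           ≈⟨ ∑-sub M _ _ ⟩
    ∑ M (λ i → c i * A i) - ∑ M (λ i → c i * η i zero * B i)
      ≈⟨ sub-cong (∑-signedSum-zero M (λ i → η i ∘ suc) (h ∘ suc) c f λ I →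
                   trans (*-congʳ (∑-cong M λ i → *-congˡ (sym (*-identityˡ _)))) (zeros (false ∷ I)))
                (∑-signedSum-zero M (λ i → η i ∘ suc) (h ∘ suc) (λ i → c i * η i zero) _ λ I →
                   trans (*-congʳ (∑-cong M λ i → *-assoc _ _ _)) (zeros (true ∷ I))) ⟩
    0# - 0#                                                ≈⟨ -‿inverseʳ 0# ⟩
    0#                                                     ∎
    where
    A B : ℕ → Carrier
    A i = signedSum (η i ∘ suc) (h ∘ suc) f
    B i = signedSum (η i ∘ suc) (h ∘ suc) (λ y → f (y - ι (+ h zero)))
    distribute : ∀ c a e b → c * (a - e * b) ≈ c * a - c * e * b
    distribute = solve 4 (λ c a e b → c :* (a :- e :* b) := c :* a :- c :* e :* b) refl

  node≈-subsetSum : ∀ {j} (h : Fin j → ℕ) I → node h I ≈ - ι (+ subsetSum h I)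
  node≈-subsetSum h []          = sym (trans (-‿cong ι-0) -0#≈0#)
  node≈-subsetSum h (true ∷ I)  = trans (+-congʳ (node≈-subsetSum (h ∘ suc) I))
    (trans (solve 2 (λ q h → :- q :- h := :- (h :+ q)) refl _ _) (-‿cong (sym (ι-+ (+ h zero) _))))
  node≈-subsetSum h (false ∷ I) = node≈-subsetSum (h ∘ suc) I

  shiftSum : ∀ {j} → (Fin j → ℤ) → (Fin j → ℕ) → Subset j → ℤ
  shiftSum a h []      = + 0
  shiftSum a h (b ∷ I) = (if b then a zero ℤ.* + h zero else + 0) ℤ.+ shiftSum (a ∘ suc) (h ∘ suc) I

  monomial-character : ∀ {j} (a : Fin j → ℤ) h x I →
    monomial (character a h x) I ≈ E (x ℤ.* + subsetSum h I ℤ.- shiftSum a h I)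
  monomial-character a h x []          = sym (trans (E-≡ (vanish x)) E-0)
    where
    vanish : ∀ x → x ℤ.* + 0 ℤ.- + 0 ≡ + 0
    vanish = solve-∀
  monomial-character a h x (true ∷ I)  = trans (*-congˡ (monomial-character (a ∘ suc) (h ∘ suc) x I))
    (trans (sym (E-+ _ _)) (E-≡ (collect x (a zero) (+ h zero) _ _)))
    where
    collect : ∀ x a h q A → (x ℤ.- a) ℤ.* h ℤ.+ (x ℤ.* q ℤ.- A) ≡ x ℤ.* (h ℤ.+ q) ℤ.- (a ℤ.* h ℤ.+ A)
    collect = solve-∀
  monomial-character a h x (false ∷ I) = trans (*-identityˡ _) (trans (monomial-character (a ∘ suc) (h ∘ suc) x I)
    (E-≡ (cong (λ A → x ℤ.* + subsetSum (h ∘ suc) I ℤ.- A) (≡.sym (ℤ.+-identityˡ _)))))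

  -- The roots are the -v because f is evaluated at negated exponents. The redundant-looking
  -- `1# * y` gives the factor the shape of `Poly-linear*`.
  vanishingOn : ∀ {d} → Vec ℕ d → Carrier → Carrier
  vanishingOn []       y = 1#
  vanishingOn (v ∷ vs) y = (ι (+ v) + 1# * y) * vanishingOn vs y

  vanishingOn-Poly : ∀ {d} (vs : Vec ℕ d) → Poly d 1# (vanishingOn vs)
  vanishingOn-Poly []       = constant λ _ → refl
  vanishingOn-Poly (v ∷ vs) = Poly-cong (*-identityˡ 1#) (λ _ → refl) (Poly-linear* (ι (+ v)) 1# (vanishingOn-Poly vs))

  vanishingOn-root : ∀ {d v y} {vs : Vec ℕ d} → v ∈ vs → y ≈ - ι (+ v) → vanishingOn vs y ≈ 0#
  vanishingOn-root (here ≡.refl) y≈-v = trans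
    (*-congʳ (trans (+-congˡ (trans (*-identityˡ _) y≈-v)) (-‿inverseʳ _))) (zeroˡ _)
  vanishingOn-root (there v∈vs)  y≈-v = trans (*-congˡ (vanishingOn-root v∈vs y≈-v)) (zeroʳ _)

  module _ {j} (a : Fin j → ℤ) (n h : Fin j → ℕ) (nh≡N : ∀ s → n s ℕ.* h s ≡ N)
           (a₀ : ℤ) (n₀ h₀ : ℕ) (n₀h₀≡N : n₀ ℕ.* h₀ ≡ N) (μ : ℕ)
           (exact    : ∀ x → + n₀ ∣ x ℤ.- a₀ → w a n x ≡ μ)
           (over     : ∀ x → ¬ (+ n₀ ∣ x ℤ.- a₀) → μ ℕ.< w a n x)
           (periodic : ∀ x → w a n (x ℤ.+ + n₀) ≡ w a n x)
           (h≉0 : ∀ s → ι (+ h s) ≉ 0#) (h₀≉0 : ι (+ h₀) ≉ 0#) (μ!≉0 : ι (+ (μ !)) ≉ 0#)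
           (r : ℕ) (vs : Vec ℕ μ)
           (captured : ∀ I → + N ∣ + subsetSum h I ℤ.- + (r ℕ.* h₀) → subsetSum h I ∈ vs) where
    private
      R = + (r ℕ.* h₀)
      f = vanishingOn vs

      c : ℕ → Carrier
      c i = E (ℤ.- (R ℤ.* + i))

      term : ℕ → Carrier
      term i = c i * signedSum (character a h (+ i)) h f

      C : Carrier
      C = E (ℤ.- (R ℤ.* a₀)) * (ι (+ (μ !)) * 1# * leading a n h a₀)

      n₀≢0 : ℕ.NonZero n₀
      n₀≢0 = ℕ.≢-nonZero λ { ≡.refl → ℕ.≢-nonZero⁻¹ N (≡.sym n₀h₀≡N) }

    character-sum : ∀ I i → c i * monomial (character a h (+ i)) I ≈
      E (ℤ.- shiftSum a h I) * E (+ subsetSum h I ℤ.- R) ^ i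
    character-sum I i = begin
      c i * monomial (character a h (+ i)) I                                 ≈⟨ *-congˡ (monomial-character a h (+ i) I) ⟩
      c i * E (+ i ℤ.* + subsetSum h I ℤ.- shiftSum a h I)                   ≈⟨ E-+ _ _ ⟨
      E (ℤ.- (R ℤ.* + i) ℤ.+ (+ i ℤ.* + subsetSum h I ℤ.- shiftSum a h I))   ≈⟨ E-≡ (collect R (+ i) (+ subsetSum h I) (shiftSum a h I)) ⟩
      E (ℤ.- shiftSum a h I ℤ.+ (+ subsetSum h I ℤ.- R) ℤ.* + i)             ≈⟨ E-+ _ _ ⟩
      E (ℤ.- shiftSum a h I) * E ((+ subsetSum h I ℤ.- R) ℤ.* + i)           ≈⟨ *-congˡ (E-^ _ i) ⟩
      E (ℤ.- shiftSum a h I) * E (+ subsetSum h I ℤ.- R) ^ i                 ∎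
      where
      collect : ∀ R i q A → ℤ.- (R ℤ.* i) ℤ.+ (i ℤ.* q ℤ.- A) ≡ ℤ.- A ℤ.+ (q ℤ.- R) ℤ.* i
      collect = solve-∀

    -- An exponent congruent to R modulo N is captured, so f vanishes there. For any other exponent
    -- q the sum over i is geometric with ratio E (q - R), an N-th root of unity different from 1.
    ∑-term≈0 : ∑ N term ≈ 0#
    ∑-term≈0 = ∑-signedSum-zero N (λ i → character a h (+ i)) h c f zeros
      where
      zeros : ∀ I → ∑ N (λ i → c i * monomial (character a h (+ i)) I) * f (node h I) ≈ 0#
      zeros I with + N ∣? + subsetSum h I ℤ.- R
      ... | yes N∣ = trans (*-congˡ (vanishingOn-root (captured I N∣) (node≈-subsetSum h I))) (zeroʳ _)
      ... | no N∤ = begin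
        ∑ N (λ i → c i * monomial (character a h (+ i)) I) * f (node h I)
          ≈⟨ *-congʳ (trans (∑-cong N (character-sum I)) (∑-scale N _ _)) ⟩
        E (ℤ.- shiftSum a h I) * ∑ N (λ i → E (+ subsetSum h I ℤ.- R) ^ i) * f (node h I)
          ≈⟨ *-congʳ (*-congˡ (geometric-zero N (N∤ ∘ E≈1⇒∣)
               (trans (sym (E-^ _ N)) (∣⇒E≈1 (divides (+ subsetSum h I ℤ.- R) ≡.refl))))) ⟩
        E (ℤ.- shiftSum a h I) * 0# * f (node h I)
          ≈⟨ trans (*-congʳ (zeroʳ _)) (zeroˡ _) ⟩
        0# ∎

    leading-periodic : ∀ {x y} → + n₀ ∣ x ℤ.- y → leading a n h x ≈ leading a n h y
    leading-periodic {x} {y} n₀∣ = begin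
      leading a n h x                                  ≈⟨ leading-∏ a n h nh≡N x ⟩
      ∏ N (λ u → rootFactor u ^ w a n (x ℤ.- + u))
        ≈⟨ ∏-cong N (λ u → reflexive (cong (rootFactor u ^_) (periodic⇒∣ (w a n) n₀ periodic
             (subst (+ n₀ ∣_) (insert x y (+ u)) n₀∣)))) ⟩
      ∏ N (λ u → rootFactor u ^ w a n (y ℤ.- + u))     ≈⟨ leading-∏ a n h nh≡N y ⟨
      leading a n h y                                  ∎
      where
      insert : ∀ x y u → x ℤ.- y ≡ (x ℤ.- u) ℤ.- (y ℤ.- u)
      insert = solve-∀

    term-value : ∀ i → term i ≈ (if does (+ n₀ ∣? a₀ ℤ.- + i) then C else 0#)
    term-value i with + n₀ ∣? a₀ ℤ.- + i
    ... | yes n₀∣ = trans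
      -- The weight is constant on the class: R = r h₀ and n₀ h₀ = N, so changing i by a multiple of
      -- n₀ changes R i by a multiple of N.
      (*-cong (E-periodic (subst (+ N ∣_)
                 (≡.trans (rearrange (+ r) (+ h₀) a₀ (+ i)) (cong (λ R → ℤ.- (R ℤ.* + i) ℤ.- ℤ.- (R ℤ.* a₀)) (≡.sym (ℤ.pos-* r h₀))))
                 (∣n⇒∣m*n (+ r) (scale-∣ n₀h₀≡N n₀∣))))
              (trans (signedSum-leading a n h nh≡N (+ i) (vanishingOn-Poly vs) (exact (+ i) n₀∣′))
                     (*-congˡ (leading-periodic n₀∣′))))
      (reflexive (cong (if_then C else 0#) (≡.sym (dec-true (+ n₀ ∣? _) n₀∣))))
      where
      rearrange : ∀ r h a i → r ℤ.* ((a ℤ.- i) ℤ.* h) ≡ ℤ.- (r ℤ.* h ℤ.* i) ℤ.- ℤ.- (r ℤ.* h ℤ.* a)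
      rearrange = solve-∀
      n₀∣′ : + n₀ ∣ + i ℤ.- a₀
      n₀∣′ = flip-∣ {x = a₀} {+ i} n₀∣
    ... | no n₀∤ = trans
      (trans (*-congˡ (signedSum-vanishes a n h nh≡N (+ i) (vanishingOn-Poly vs)
                (over (+ i) λ n₀∣ → n₀∤ (flip-∣ {x = + i} {a₀} n₀∣))))
             (zeroʳ _))
      (reflexive (cong (if_then C else 0#) (≡.sym (dec-false (+ n₀ ∣? _) n₀∤))))

    -- The class of a₀ modulo n₀ has h₀ points below N = h₀ n₀, each contributing C.
    ∑-term-value : ∑ N term ≈ C * ι (+ h₀)
    ∑-term-value = begin
      ∑ N term                                                                 ≈⟨ ∑-cong N term-value ⟩
      ∑ N (λ i → if does (+ n₀ ∣? a₀ ℤ.- + i) then C else 0#)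
        ≡⟨ cong (λ m → ∑ m (λ i → if does (+ n₀ ∣? a₀ ℤ.- + i) then C else 0#)) (≡.trans (ℕ.*-comm h₀ n₀) n₀h₀≡N) ⟨
      ∑ (h₀ ℕ.* n₀) (λ i → if does (+ n₀ ∣? a₀ ℤ.- + i) then C else 0#)        ≈⟨ ∑-residue h₀ n₀ {{n₀≢0}} a₀ (λ _ → C) ⟩
      ∑ h₀ (λ _ → C)                                                           ≈⟨ ∑-cong h₀ (λ _ → *-identityʳ C) ⟨
      ∑ h₀ (λ _ → C * 1#)                                                      ≈⟨ ∑-scale h₀ C (λ _ → 1#) ⟩
      C * ∑ h₀ (λ _ → 1#)                                                      ≈⟨ *-congˡ (∑-ones h₀) ⟩
      C * ι (+ h₀)                                                             ∎

    not-captured : ⊥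
    not-captured = *-≉0 (*-≉0 (E≉0 _) (*-≉0 (*-≉0 μ!≉0 1≉0) (leading≉0 a n h nh≡N h≉0 a₀))) h₀≉0
      (trans (sym ∑-term-value) ∑-term≈0)

-- A prime modulo which a given base has order N.

cofactor : ℕ → ℕ → ℕ
cofactor N zero        = 0
cofactor N q@(suc _) = N ℕ./ q

*-cofactor : ∀ {N q} .{{_ : ℕ.NonZero q}} → q ℕ.∣ N → q ℕ.* cofactor N q ≡ N
*-cofactor {q = suc _} q∣N = ℕ.m*[n/m]≡n q∣N

power-pred : ∀ b .{{_ : ℕ.NonZero b}} x → suc (b ℕ.^ x ℕ.∸ 1) ≡ b ℕ.^ x
power-pred b x = ℕ.m+[n∸m]≡n (ℕ.m^n>0 b x)

ℤ-power-pred : ∀ b .{{_ : ℕ.NonZero b}} x → + (b ℕ.^ x ℕ.∸ 1) ≡ + (b ℕ.^ x) ℤ.- + 1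
ℤ-power-pred b x = ≡.trans (lemma (+ (b ℕ.^ x ℕ.∸ 1))) (cong (λ k → + k ℤ.- + 1) (power-pred b x))
  where
  lemma : ∀ z → z ≡ (+ 1 ℤ.+ z) ℤ.- + 1
  lemma = solve-∀

power-pred-multiple : ∀ b .{{_ : ℕ.NonZero b}} n k → + (b ℕ.^ n ℕ.∸ 1) ∣ + (b ℕ.^ (k ℕ.* n)) ℤ.- + 1
power-pred-multiple b n zero    = divides (+ 0) ≡.refl
power-pred-multiple b n (suc k) = subst (+ (b ℕ.^ n ℕ.∸ 1) ∣_) (≡.sym expand)
  (∣m∣n⇒∣m+n (∣n⇒∣m*n (+ (b ℕ.^ n)) (power-pred-multiple b n k)) (divides (+ 1) (≡.sym (≡.trans (ℤ.*-identityˡ _) (ℤ-power-pred b n)))))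
  where
  telescope : ∀ g y → g ℤ.* y ℤ.- + 1 ≡ g ℤ.* (y ℤ.- + 1) ℤ.+ (g ℤ.- + 1)
  telescope = solve-∀
  expand : + (b ℕ.^ (suc k ℕ.* n)) ℤ.- + 1 ≡ + (b ℕ.^ n) ℤ.* (+ (b ℕ.^ (k ℕ.* n)) ℤ.- + 1) ℤ.+ (+ (b ℕ.^ n) ℤ.- + 1)
  expand = ≡.trans (cong (λ z → z ℤ.- + 1) (≡.trans (cong +_ (ℕ.^-distribˡ-+-* b n (k ℕ.* n))) (ℤ.pos-* (b ℕ.^ n) _)))
                   (telescope (+ (b ℕ.^ n)) (+ (b ℕ.^ (k ℕ.* n))))

prime-divisor : ∀ {n} → n ≢ 0 → n ≢ 1 → ∃ λ p → Prime p × p ℕ.∣ n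
prime-divisor {n} n≢0 n≢1 with factorise n {{ℕ.≢-nonZero n≢0}}
... | record { factors = [] ; isFactorisation = n≡1 } = ⊥-elim (n≢1 n≡1)
... | record { factors = p ∷ ps ; isFactorisation = n≡ ; factorsPrime = pr ∷ _ } =
  p , pr , ℕ.divides (product ps) (≡.trans n≡ (ℕ.*-comm p (product ps)))

module PowerProduct (N b : ℕ) .{{N≢0 : ℕ.NonZero N}} .{{b≢0 : ℕ.NonZero b}} where
  Q : ℕ
  Q = b ℕ.^ N ℕ.∸ 1

  factor : ℕ → ℕ
  factor q = b ℕ.^ cofactor N q ℕ.∸ 1

  powerProduct : List ℕ → ℕ
  powerProduct []       = 1
  powerProduct (q ∷ qs) = factor q ℕ.* powerProduct qs

  -- Expanding the product gives 2 ^ `length qs` signed powers of b, each at most b^(N-1) once its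
  -- exponent is reduced modulo N.
  bound : List ℕ → ℕ
  bound qs = 2 ℕ.^ length qs ℕ.* b ℕ.^ (N ℕ.∸ 1)

  -- X is the expanded product with reduced exponents. The size of X and its divisibility by b
  -- (through P) are followed together, since only their combination excludes that Q divides z.
  Reduced : ℤ → ℕ → (ℤ → Set) → Set
  Reduced z B P = Σ ℤ λ X → + Q ∣ z ℤ.- X × ℤ.∣ X ∣ ℕ.≤ B × P X

  IsCofactored : ℕ → Set
  IsCofactored q = q ℕ.* cofactor N q ≡ N

  -- One factor is opened: b^x (b^c - 1) e = b^(x+c) e - b^x e. The two representatives are
  -- subtracted, so their bounds add up.
  step : ∀ x q qs {P₁ P₂ P : ℤ → Set} → (∀ {X₁ X₂} → P₁ X₁ → P₂ X₂ → P (X₁ ℤ.- X₂)) →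
    Reduced (+ (b ℕ.^ (x ℕ.+ cofactor N q)) ℤ.* + powerProduct qs) (bound qs) P₁ →
    Reduced (+ (b ℕ.^ x) ℤ.* + powerProduct qs) (bound qs) P₂ →
    Reduced (+ (b ℕ.^ x) ℤ.* + powerProduct (q ∷ qs)) (bound (q ∷ qs)) P
  step x q qs combine (X₁ , d₁ , ≤₁ , p₁) (X₂ , d₂ , ≤₂ , p₂) =
    X₁ ℤ.- X₂ , subst (+ Q ∣_) split (∣m∣n⇒∣m-n d₁ d₂) , small , combine p₁ p₂
    where
    rearrange : ∀ y g e X₁ X₂ → y ℤ.* g ℤ.* e ℤ.- X₁ ℤ.- (y ℤ.* e ℤ.- X₂) ≡ y ℤ.* ((g ℤ.- + 1) ℤ.* e) ℤ.- (X₁ ℤ.- X₂)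
    rearrange = solve-∀
    c = cofactor N q
    e = powerProduct qs
    split : + (b ℕ.^ (x ℕ.+ c)) ℤ.* + e ℤ.- X₁ ℤ.- (+ (b ℕ.^ x) ℤ.* + e ℤ.- X₂)
            ≡ + (b ℕ.^ x) ℤ.* + powerProduct (q ∷ qs) ℤ.- (X₁ ℤ.- X₂)
    split = begin
      + (b ℕ.^ (x ℕ.+ c)) ℤ.* + e ℤ.- X₁ ℤ.- (+ (b ℕ.^ x) ℤ.* + e ℤ.- X₂)
        ≡⟨ cong (λ z → z ℤ.* + e ℤ.- X₁ ℤ.- (+ (b ℕ.^ x) ℤ.* + e ℤ.- X₂))
             (≡.trans (cong +_ (ℕ.^-distribˡ-+-* b x c)) (ℤ.pos-* (b ℕ.^ x) (b ℕ.^ c))) ⟩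
      + (b ℕ.^ x) ℤ.* + (b ℕ.^ c) ℤ.* + e ℤ.- X₁ ℤ.- (+ (b ℕ.^ x) ℤ.* + e ℤ.- X₂)
        ≡⟨ rearrange (+ (b ℕ.^ x)) (+ (b ℕ.^ c)) (+ e) X₁ X₂ ⟩
      + (b ℕ.^ x) ℤ.* ((+ (b ℕ.^ c) ℤ.- + 1) ℤ.* + e) ℤ.- (X₁ ℤ.- X₂)
        ≡⟨ cong (λ z → + (b ℕ.^ x) ℤ.* z ℤ.- (X₁ ℤ.- X₂))
             (≡.trans (cong (ℤ._* + e) (≡.sym (ℤ-power-pred b c))) (≡.sym (ℤ.pos-* (factor q) e))) ⟩
      + (b ℕ.^ x) ℤ.* + powerProduct (q ∷ qs) ℤ.- (X₁ ℤ.- X₂)  ∎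
      where open ≡.≡-Reasoning
    small : ℤ.∣ X₁ ℤ.- X₂ ∣ ℕ.≤ bound (q ∷ qs)
    small = begin
      ℤ.∣ X₁ ℤ.- X₂ ∣            ≤⟨ ℤ.∣i-j∣≤∣i∣+∣j∣ X₁ X₂ ⟩
      ℤ.∣ X₁ ∣ ℕ.+ ℤ.∣ X₂ ∣      ≤⟨ ℕ.+-mono-≤ ≤₁ ≤₂ ⟩
      bound qs ℕ.+ bound qs      ≡⟨ cong (bound qs ℕ.+_) (ℕ.+-identityʳ (bound qs)) ⟨
      2 ℕ.* bound qs             ≡⟨ ℕ.*-assoc 2 (2 ℕ.^ length qs) _ ⟨
      bound (q ∷ qs)             ∎
      where open ℕ.≤-Reasoning

  b∣power : ∀ {x} → x ≢ 0 → + b ∣ + (b ℕ.^ x)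
  b∣power {zero}  x≢0 = ⊥-elim (x≢0 ≡.refl)
  b∣power {suc x} x≢0 = ∣ᵤ⇒∣ (ℕ.m∣m*n (b ℕ.^ x))

  -- The hypothesis excludes that x plus a subsum of the N/q is divisible by N.
  reduce-shifted : ∀ qs x → All IsCofactored qs → ¬ (N ℕ.∣ product qs ℕ.* x) →
    Reduced (+ (b ℕ.^ x) ℤ.* + powerProduct qs) (bound qs) (+ b ∣_)
  reduce-shifted [] x [] N∤ = + (b ℕ.^ (x ℕ.% N)) , subst (+ Q ∣_) (≡.sym factorisation)
      (∣n⇒∣m*n (+ (b ℕ.^ (x ℕ.% N))) (power-pred-multiple b N (x ℕ./ N)))
    , ℕ.≤-trans (ℕ.^-monoʳ-≤ b (ℕ.≤-pred (subst (suc (x ℕ.% N) ℕ.≤_) (≡.sym (ℕ.suc-pred N)) (ℕ.m%n<n x N))))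
                (ℕ.≤-reflexive (≡.sym (ℕ.*-identityˡ _)))
    , b∣power λ x%N≡0 → N∤ (subst (N ℕ.∣_) (≡.sym (ℕ.*-identityˡ x)) (ℕ.m%n≡0⇒n∣m x N x%N≡0))
    where
    rearrange : ∀ y z → y ℤ.* z ℤ.* + 1 ℤ.- y ≡ y ℤ.* (z ℤ.- + 1)
    rearrange = solve-∀
    factorisation : + (b ℕ.^ x) ℤ.* + 1 ℤ.- + (b ℕ.^ (x ℕ.% N))
                    ≡ + (b ℕ.^ (x ℕ.% N)) ℤ.* (+ (b ℕ.^ (x ℕ./ N ℕ.* N)) ℤ.- + 1)
    factorisation = ≡.trans (cong (λ z → z ℤ.* + 1 ℤ.- + (b ℕ.^ (x ℕ.% N)))
        (≡.trans (cong (λ x → + (b ℕ.^ x)) (ℕ.m≡m%n+[m/n]*n x N))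
        (≡.trans (cong +_ (ℕ.^-distribˡ-+-* b (x ℕ.% N) _)) (ℤ.pos-* (b ℕ.^ (x ℕ.% N)) _))))
      (rearrange (+ (b ℕ.^ (x ℕ.% N))) _)
  reduce-shifted (q ∷ qs) x (qc≡N ∷ cs) N∤ = step x q qs ∣m∣n⇒∣m-n
    -- Multiplication by q turns the new summand c = N/q of the exponent into a multiple of N.
    (reduce-shifted qs (x ℕ.+ c) cs λ N∣ → N∤ (ℕ.∣m+n∣m⇒∣n (subst (N ℕ.∣_) (≡.trans expand (ℕ.+-comm _ (product qs ℕ.* N))) (ℕ.∣n⇒∣m*n q N∣)) (ℕ.n∣m*n (product qs))))
    (reduce-shifted qs x cs λ N∣ → N∤ (subst (N ℕ.∣_) (≡.sym (ℕ.*-assoc q (product qs) x)) (ℕ.∣n⇒∣m*n q N∣)))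
    where
    c = cofactor N q
    expand : q ℕ.* (product qs ℕ.* (x ℕ.+ c)) ≡ q ℕ.* product qs ℕ.* x ℕ.+ product qs ℕ.* N
    expand = begin
      q ℕ.* (product qs ℕ.* (x ℕ.+ c))                     ≡⟨ ℕ.*-assoc q (product qs) (x ℕ.+ c) ⟨
      q ℕ.* product qs ℕ.* (x ℕ.+ c)                       ≡⟨ ℕ.*-distribˡ-+ (q ℕ.* product qs) x c ⟩
      q ℕ.* product qs ℕ.* x ℕ.+ q ℕ.* product qs ℕ.* c    ≡⟨ cong (λ z → q ℕ.* product qs ℕ.* x ℕ.+ z ℕ.* c) (ℕ.*-comm q (product qs)) ⟩
      q ℕ.* product qs ℕ.* x ℕ.+ product qs ℕ.* q ℕ.* c    ≡⟨ cong (λ z → q ℕ.* product qs ℕ.* x ℕ.+ z) (ℕ.*-assoc (product qs) q c) ⟩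
      q ℕ.* product qs ℕ.* x ℕ.+ product qs ℕ.* (q ℕ.* c)  ≡⟨ cong (λ z → q ℕ.* product qs ℕ.* x ℕ.+ product qs ℕ.* z) qc≡N ⟩
      q ℕ.* product qs ℕ.* x ℕ.+ product qs ℕ.* N          ∎
      where open ≡.≡-Reasoning

  -- In the opened factor, the branch that takes b^c has exponents never divisible by N: otherwise q
  -- would divide the product of the other primes. So that branch is a multiple of b, and the other
  -- branch leads down to the single term 1, which is not.
  reduce : b ≢ 1 → ∀ qs → All IsCofactored qs → All Prime qs → Unique qs →
    Reduced (+ (b ℕ.^ 0) ℤ.* + powerProduct qs) (bound qs) (λ X → ¬ (+ b ∣ X))
  reduce b≢1 [] [] [] [] = + 1 , divides (+ 0) ≡.refl
    , ℕ.≤-trans (ℕ.m^n>0 b (N ℕ.∸ 1)) (ℕ.≤-reflexive (≡.sym (ℕ.*-identityˡ _)))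
    , λ b∣1 → b≢1 (ℕ.∣1⇒≡1 (∣⇒∣ᵤ b∣1))
  reduce b≢1 (q ∷ qs) (qc≡N ∷ cs) (pr ∷ prs) (q∉qs ∷ unique) = step 0 q qs
    (λ {X₁} {X₂} b∣X₁ b∤X₂ b∣X₁-X₂ → b∤X₂ (subst (+ b ∣_) (i-[i-j]≡j X₁ X₂) (∣m∣n⇒∣m-n b∣X₁ b∣X₁-X₂)))
    (reduce-shifted qs c cs λ N∣ → All.lookup q∉qs (factorisationHasAllPrimeFactors pr
      (ℕ.*-cancelʳ-∣ c {{c≢0}} (subst (ℕ._∣ product qs ℕ.* c) (≡.sym qc≡N) N∣)) prs) ≡.refl)
    (reduce b≢1 qs cs prs unique)
    where
    c = cofactor N q
    c≢0 : ℕ.NonZero c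
    c≢0 = ℕ.≢-nonZero λ c≡0 → ℕ.≢-nonZero⁻¹ N (≡.trans (≡.sym qc≡N) (≡.trans (cong (q ℕ.*_) c≡0) (ℕ.*-zeroʳ q)))

  -- Otherwise the reduced value X would be a multiple of Q of absolute value below Q, hence 0,
  -- although b does not divide it.
  Q∤powerProduct : ∀ qs → All IsCofactored qs → All Prime qs → Unique qs → 2 ℕ.^ length qs ℕ.+ 2 ℕ.≤ b →
    ¬ (Q ℕ.∣ powerProduct qs)
  Q∤powerProduct qs cs prs unique large Q∣ with reduce b≢1 qs cs prs unique
    where
    b≢1 : b ≢ 1
    b≢1 b≡1 = ℕ.<⇒≢ (ℕ.≤-trans (ℕ.m≤n+m 2 (2 ℕ.^ length qs)) large) (≡.sym b≡1)
  ... | X , Q∣-X , small , b∤X = b∤X (subst (+ b ∣_) (≡.sym X≡0) (divides (+ 0) ≡.refl))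
    where
    Q∣X : + Q ∣ X
    Q∣X = subst (+ Q ∣_) (i-[i-j]≡j (+ (b ℕ.^ 0) ℤ.* + powerProduct qs) X)
      (∣m∣n⇒∣m-n (∣n⇒∣m*n (+ (b ℕ.^ 0)) {+ powerProduct qs} (∣ᵤ⇒∣ Q∣)) Q∣-X)
    bound<Q : bound qs ℕ.< Q
    bound<Q = ℕ.s≤s⁻¹ (begin
      -- The summand 2 in `large` pays for the 1 subtracted in Q and for the strictness of the
      -- inequality.
      2 ℕ.+ bound qs                                         ≤⟨ ℕ.+-monoˡ-≤ (bound qs) (ℕ.*-monoʳ-≤ 2 (ℕ.m^n>0 b (N ℕ.∸ 1))) ⟩
      2 ℕ.* b ℕ.^ (N ℕ.∸ 1) ℕ.+ bound qs                     ≡⟨ ℕ.*-distribʳ-+ (b ℕ.^ (N ℕ.∸ 1)) 2 (2 ℕ.^ length qs) ⟨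
      (2 ℕ.+ 2 ℕ.^ length qs) ℕ.* b ℕ.^ (N ℕ.∸ 1)            ≤⟨ ℕ.*-monoˡ-≤ (b ℕ.^ (N ℕ.∸ 1)) (ℕ.≤-trans (ℕ.≤-reflexive (ℕ.+-comm 2 _)) large) ⟩
      b ℕ.* b ℕ.^ (N ℕ.∸ 1)                                  ≡⟨ cong (b ℕ.^_) (ℕ.suc-pred N) ⟩
      b ℕ.^ N                                                ≡⟨ power-pred b N ⟨
      suc Q                                                  ∎)
      where open ℕ.≤-Reasoning
    X≡0 : X ≡ + 0
    X≡0 = ℤ.∣i∣≡0⇒i≡0 (m∣n∧n<m⇒n≡0 (∣⇒∣ᵤ Q∣X) (ℕ.≤-<-trans small bound<Q))

-- With g = u + 1, s is 1 + g + ... + g^(q-1), built by s ↦ 1 + g s. The number k witnesses that s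
-- is q modulo u.
geometric-quotient : ∀ u q → ∃ λ s → suc u ℕ.^ q ≡ suc (u ℕ.* s) × (∃ λ k → s ≡ q ℕ.+ u ℕ.* k)
geometric-quotient u zero    = 0 , cong suc (≡.sym (ℕ.*-zeroʳ u)) , 0 , ≡.sym (ℕ.*-zeroʳ u)
geometric-quotient u (suc q) with geometric-quotient u q
... | s , power , k , s≡ = suc (s ℕ.+ u ℕ.* s)
  , ≡.trans (cong (suc u ℕ.*_) power) (power-step u s)
  , s ℕ.+ k , cong suc (≡.trans (cong (ℕ._+ u ℕ.* s) s≡) (remainder-step q u k s))
  where
  power-step : ∀ u s → suc u ℕ.* suc (u ℕ.* s) ≡ suc (u ℕ.* suc (s ℕ.+ u ℕ.* s))
  power-step = ℕ.solve-∀
  remainder-step : ∀ q u k s → q ℕ.+ u ℕ.* k ℕ.+ u ℕ.* s ≡ q ℕ.+ u ℕ.* (s ℕ.+ k)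
  remainder-step = ℕ.solve-∀

-- The conditions `p∣` and `p∤` say that `base` has order exactly N modulo p, as `order-divides`
-- shows; `p∤K` keeps all divisors of K nonzero modulo p.
record PrimitivePrime (N K : ℕ) : Set where
  field
    base p      : ℕ
    .{{base≢0}} : ℕ.NonZero base
    prime       : Prime p
    p∤K         : ¬ (p ℕ.∣ K)
    p∣          : p ℕ.∣ base ℕ.^ N ℕ.∸ 1
    p∤          : ∀ {q} → Prime q → q ℕ.∣ N → ¬ (p ℕ.∣ base ℕ.^ cofactor N q ℕ.∸ 1)

∣-power : ∀ {p b} n → n ≢ 0 → p ℕ.∣ b → p ℕ.∣ b ℕ.^ n
∣-power zero    n≢0 p∣b = ⊥-elim (n≢0 ≡.refl)
∣-power (suc n) n≢0 p∣b = ℕ.∣m⇒∣m*n _ p∣b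

∣-consecutive : ∀ {p m} → p ℕ.∣ m → p ℕ.∣ suc m → p ≡ 1
∣-consecutive {p} {m} p∣m p∣1+m = ℕ.∣1⇒≡1 (ℕ.∣m+n∣m⇒∣n (subst (p ℕ.∣_) (ℕ.+-comm 1 m) p∣1+m) p∣m)

-- The quotient of b^N - 1 by its gcd with the product of the b^(N/q) - 1 divides
-- 1 + g + ... + g^(q-1) for g = b^(N/q), which is q modulo g - 1.
module PrimitivePrimeDivisor
  (N K b : ℕ) .{{N≢0 : ℕ.NonZero N}} .{{b≢0 : ℕ.NonZero b}} (N∣b : N ℕ.∣ b) (K∣b : K ℕ.∣ b)
  (qs : List ℕ) (prime-divisors : All (λ q → Prime q × q ℕ.∣ N) qs)
  (complete : ∀ {q} → Prime q → q ℕ.∣ N → q List.∈ qs) (unique : Unique qs)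
  (large : 2 ℕ.^ length qs ℕ.+ 2 ℕ.≤ b) where
  open PowerProduct N b

  e : ℕ
  e = powerProduct qs

  Q∤e : ¬ (Q ℕ.∣ e)
  Q∤e = Q∤powerProduct qs
    (All.map (λ { (q-prime , q∣N) → *-cofactor {{prime⇒nonZero q-prime}} q∣N }) prime-divisors)
    (All.map proj₁ prime-divisors) unique large

  G = gcd Q e
  M = ℕ.quotient (gcd[m,n]∣m Q e)
  Q≡MG : Q ≡ M ℕ.* G
  Q≡MG = ℕ._∣_.equality (gcd[m,n]∣m Q e)
  Q≢0 : Q ≢ 0
  Q≢0 Q≡0 = ℕ.<⇒≢ (ℕ.≤-trans (ℕ.≤-trans (ℕ.m≤n+m 2 (2 ℕ.^ length qs)) large)
    (ℕ.≤-trans (ℕ.≤-reflexive (≡.sym (ℕ.*-identityʳ b))) (ℕ.^-monoʳ-≤ b (ℕ.>-nonZero⁻¹ N))))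
    (≡.trans (cong suc (≡.sym Q≡0)) (power-pred b N))
  -- If M were 1, then Q would equal its gcd with e and so divide e.
  divisor : ∃ λ p → Prime p × p ℕ.∣ M
  divisor = prime-divisor (λ M≡0 → Q≢0 (≡.trans Q≡MG (cong (ℕ._* G) M≡0)))
    λ M≡1 → Q∤e (subst (ℕ._∣ e) (≡.sym (≡.trans Q≡MG (≡.trans (cong (ℕ._* G) M≡1) (ℕ.*-identityˡ G)))) (gcd[m,n]∣n Q e))
  p = proj₁ divisor
  p-prime = proj₁ (proj₂ divisor)
  p∣M = proj₂ (proj₂ divisor)
  p∣Q : p ℕ.∣ Q
  p∣Q = subst (p ℕ.∣_) (≡.sym Q≡MG) (ℕ.∣m⇒∣m*n G p∣M)
  p∤b : ¬ (p ℕ.∣ b)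
  p∤b p∣b = ¬prime[1] (subst Prime (∣-consecutive p∣Q (subst (p ℕ.∣_) (≡.sym (power-pred b N)) (∣-power N (ℕ.≢-nonZero⁻¹ N) p∣b))) p-prime)
  factor∣powerProduct : ∀ {q qs} → q List.∈ qs → factor q ℕ.∣ powerProduct qs
  factor∣powerProduct {q} (here ≡.refl) = ℕ.m∣m*n _
  factor∣powerProduct (there {x} q∈) = ℕ.∣n⇒∣m*n (factor x) (factor∣powerProduct q∈)
  -- As u divides both Q and e, it divides G, so M = Q/G divides s = Q/u. From p ∣ u it then follows
  -- that p ∣ q ∣ N ∣ b, which `p∤b` excludes.
  p∤factor : ∀ {q} → Prime q → q ℕ.∣ N → ¬ (p ℕ.∣ factor q)
  p∤factor {q} q-prime q∣N p∣u = p∤b (ℕ.∣-trans p∣q (ℕ.∣-trans q∣N N∣b))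
    where
    u = factor q
    s = proj₁ (geometric-quotient u q)
    power = proj₁ (proj₂ (geometric-quotient u q))
    k = proj₁ (proj₂ (proj₂ (geometric-quotient u q)))
    s≡ = proj₂ (proj₂ (proj₂ (geometric-quotient u q)))
    c = cofactor N q
    cq≡N : c ℕ.* q ≡ N
    cq≡N = ≡.trans (ℕ.*-comm c q) (*-cofactor {{prime⇒nonZero q-prime}} q∣N)
    Q≡us : Q ≡ u ℕ.* s
    Q≡us = cong ℕ.pred (begin
      suc Q                  ≡⟨ power-pred b N ⟩
      b ℕ.^ N                ≡⟨ cong (b ℕ.^_) cq≡N ⟨
      b ℕ.^ (c ℕ.* q)        ≡⟨ ℕ.^-*-assoc b c q ⟨
      (b ℕ.^ c) ℕ.^ q        ≡⟨ cong (ℕ._^ q) (power-pred b c) ⟨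
      suc u ℕ.^ q            ≡⟨ power ⟩
      suc (u ℕ.* s)          ∎)
      where open ≡.≡-Reasoning
    u≢0 : ℕ.NonZero u
    u≢0 = ℕ.≢-nonZero λ u≡0 → Q≢0 (≡.trans Q≡us (cong (ℕ._* s) u≡0))
    u∣G : u ℕ.∣ G
    u∣G = gcd-greatest (ℕ.divides s (≡.trans Q≡us (ℕ.*-comm u s)))
      (factor∣powerProduct (complete q-prime q∣N))
    M∣s : M ℕ.∣ s
    M∣s = ℕ.*-cancelʳ-∣ u {{u≢0}} (subst (M ℕ.* u ℕ.∣_) (≡.trans (≡.sym Q≡MG) (≡.trans Q≡us (ℕ.*-comm u s))) (ℕ.*-monoʳ-∣ M u∣G))
    p∣q : p ℕ.∣ q
    p∣q = ℕ.∣m+n∣m⇒∣n (subst (p ℕ.∣_) (≡.trans s≡ (ℕ.+-comm q _)) (ℕ.∣-trans p∣M M∣s)) (ℕ.∣m⇒∣m*n k p∣u)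

  primitivePrime : PrimitivePrime N K
  primitivePrime = record
    { base = b ; p = p ; base≢0 = b≢0 ; prime = p-prime
    ; p∤K = λ p∣K → p∤b (ℕ.∣-trans p∣K K∣b) ; p∣ = p∣Q ; p∤ = p∤factor }

primitive-prime : ∀ N K .{{_ : ℕ.NonZero N}} .{{_ : ℕ.NonZero K}} → PrimitivePrime N K
primitive-prime N K = primitivePrime
  where
  isPrimeDivisor? : ∀ q → Dec (Prime q × q ℕ.∣ N)
  isPrimeDivisor? q = prime? q ×-dec (q ℕ.∣? N)
  qs = filter isPrimeDivisor? (upTo (suc N))
  -- The first factor makes b large enough for the size estimate; the second makes it a multiple of
  -- N and of K.
  b = (2 ℕ.^ length qs ℕ.+ 2) ℕ.* (N ℕ.* K)
  large : 2 ℕ.^ length qs ℕ.+ 2 ℕ.≤ b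
  large = ℕ.m≤m*n _ (N ℕ.* K) {{ℕ.m*n≢0 N K}}
  open PrimitivePrimeDivisor N K b
    {{b≢0 = ℕ.>-nonZero (ℕ.≤-trans (ℕ.≤-trans (ℕ.s≤s ℕ.z≤n) (ℕ.m≤n+m 2 (2 ℕ.^ length qs))) large)}}
    (ℕ.∣n⇒∣m*n (2 ℕ.^ length qs ℕ.+ 2) (ℕ.m∣m*n K)) (ℕ.∣n⇒∣m*n (2 ℕ.^ length qs ℕ.+ 2) (ℕ.n∣m*n N)) qs (all-filter isPrimeDivisor? (upTo (suc N)))
    (λ q-prime q∣N → ∈-filter⁺ isPrimeDivisor? (∈-upTo⁺ (ℕ.s≤s (ℕ.∣⇒≤ q∣N))) (q-prime , q∣N))
    (filter⁺ isPrimeDivisor? (upTo⁺ (suc N))) large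

-- Integers modulo p and powers of a primitive root.

module ResidueRing (p : ℕ) where
  open import Data.Integer hiding (suc)
  open import Data.Integer.Properties
  open import Data.Integer.Divisibility.Signed
  open import Data.Integer.Tactic.RingSolver using (solve-∀)

  infix 4 _≈_ _≉_

  record _≈_ (x y : ℤ) : Set where
    constructor mod
    field divides-difference : + p ∣ x - y
  open _≈_ public

  _≉_ : ℤ → ℤ → Set
  x ≉ y = ¬ (x ≈ y)

  ≡⇒≈ : ∀ {x y} → x ≡ y → x ≈ y
  ≡⇒≈ {x} ≡.refl = mod (subst (+ p ∣_) (≡.sym (+-inverseʳ x)) (divides 0ℤ ≡.refl))

  ∣⇒≈0 : ∀ {x} → + p ∣ x → x ≈ 0ℤ
  ∣⇒≈0 {x} d = mod (subst (+ p ∣_) (≡.sym (+-identityʳ x)) d)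

  ≈0⇒∣ : ∀ {x} → x ≈ 0ℤ → + p ∣ x
  ≈0⇒∣ {x} (mod d) = subst (+ p ∣_) (+-identityʳ x) d

  private
    transfer : ∀ {x y} → x ≡ y → + p ∣ x → + p ∣ y
    transfer ≡.refl d = d

    trans-id : ∀ x y z → (x - y) + (y - z) ≡ x - z
    trans-id = solve-∀
    sym-id : ∀ x y → - (x - y) ≡ y - x
    sym-id = solve-∀
    +-id : ∀ x y u v → (x - y) + (u - v) ≡ (x + u) - (y + v)
    +-id = solve-∀
    *-id : ∀ x y u v → u * (x - y) + y * (u - v) ≡ x * u - y * v
    *-id = solve-∀
    neg-id : ∀ x y → - (x - y) ≡ - x - - y
    neg-id = solve-∀

  -- The carrier stays ℤ and only the equality changes, so the homomorphism from the integers is the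
  -- identity.
  ℤ/p : CommutativeRing 0ℓ 0ℓ
  ℤ/p = record
    { Carrier = ℤ ; _≈_ = _≈_ ; _+_ = _+_ ; _*_ = _*_ ; -_ = -_ ; 0# = 0ℤ ; 1# = 1ℤ
    ; isCommutativeRing = record
      { isRing = record
        { +-isAbelianGroup = record
          { isGroup = record
            { isMonoid = record
              { isSemigroup = record
                { isMagma = record
                  { isEquivalence = record
                    { refl  = ≡⇒≈ ≡.refl
                    ; sym   = λ {x} {y} (mod d) → mod (transfer (sym-id x y) (∣m⇒∣-m d))
                    ; trans = λ {x} {y} {z} (mod d) (mod e) → mod (transfer (trans-id x y z) (∣m∣n⇒∣m+n d e)) }
                  ; ∙-cong = λ {x} {y} {u} {v} (mod d) (mod e) →
                      mod (transfer (+-id x y u v) (∣m∣n⇒∣m+n d e)) }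
                ; assoc = λ x y z → ≡⇒≈ (+-assoc x y z) }
              ; identity = (≡⇒≈ ∘ +-identityˡ) , (≡⇒≈ ∘ +-identityʳ) }
            ; inverse = (≡⇒≈ ∘ +-inverseˡ) , (≡⇒≈ ∘ +-inverseʳ)
            ; ⁻¹-cong = λ {x} {y} (mod d) → mod (transfer (neg-id x y) (∣m⇒∣-m d)) }
          ; comm = λ x y → ≡⇒≈ (+-comm x y) }
        ; *-cong = λ {x} {y} {u} {v} (mod d) (mod e) →
            mod (transfer (*-id x y u v) (∣m∣n⇒∣m+n (∣n⇒∣m*n u d) (∣n⇒∣m*n y e)))
        ; *-assoc = λ x y z → ≡⇒≈ (*-assoc x y z)
        ; *-identity = (≡⇒≈ ∘ *-identityˡ) , (≡⇒≈ ∘ *-identityʳ)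
        ; distrib = (λ x y z → ≡⇒≈ (*-distribˡ-+ x y z)) , (λ x y z → ≡⇒≈ (*-distribʳ-+ x y z)) }
      ; *-comm = λ x y → ≡⇒≈ (*-comm x y) } }

module PrimitiveRoot (R : CommutativeRing 0ℓ 0ℓ) where
  open CommutativeRing R hiding (zero)
  open Powers R
  open import Relation.Binary.Reasoning.Setoid setoid

  ^-multiple : ∀ g {m n} → m ℕ.∣ n → g ^ m ≈ 1# → g ^ n ≈ 1#
  ^-multiple g {m} (ℕ.divides q ≡.refl) gᵐ≈1 = begin
    g ^ (q ℕ.* m)  ≡⟨ cong (g ^_) (ℕ.*-comm q m) ⟩
    g ^ (m ℕ.* q)  ≈⟨ ^-assocʳ g m q ⟨
    (g ^ m) ^ q    ≈⟨ ^-congˡ q gᵐ≈1 ⟩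
    1# ^ q         ≈⟨ 1^ q ⟩
    1#             ∎

  ^-absorb : ∀ g d {m} → g ^ m ≈ 1# → g ^ (d ℕ.+ m) ≈ g ^ d
  ^-absorb g d gᵐ≈1 = trans (^-homo-* g d _) (trans (*-congˡ gᵐ≈1) (*-identityʳ _))

  ^-gcd : ∀ g m n → g ^ m ≈ 1# → g ^ n ≈ 1# → g ^ gcd m n ≈ 1#
  ^-gcd g m n gᵐ≈1 gⁿ≈1 with Bézout.identity (gcd-GCD m n)
  ... | Bézout.+- x y eq = begin
    g ^ gcd m n                 ≈⟨ ^-absorb g (gcd m n) (^-multiple g (ℕ.n∣m*n y) gⁿ≈1) ⟨
    g ^ (gcd m n ℕ.+ y ℕ.* n)   ≡⟨ cong (g ^_) eq ⟩
    g ^ (x ℕ.* m)               ≈⟨ ^-multiple g (ℕ.n∣m*n x) gᵐ≈1 ⟩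
    1#                          ∎
  ... | Bézout.-+ x y eq = begin
    g ^ gcd m n                 ≈⟨ ^-absorb g (gcd m n) (^-multiple g (ℕ.n∣m*n x) gᵐ≈1) ⟨
    g ^ (gcd m n ℕ.+ x ℕ.* m)   ≡⟨ cong (g ^_) eq ⟩
    g ^ (y ℕ.* n)               ≈⟨ ^-multiple g (ℕ.n∣m*n y) gⁿ≈1 ⟩
    1#                          ∎

  -- Let d = gcd k N and N = m d; then g^d = 1. If m is not 1, a prime q dividing m makes d a
  -- divisor of N/q, so g^(N/q) = 1, contrary to the assumption.
  order-divides : ∀ g N .{{_ : ℕ.NonZero N}} → g ^ N ≈ 1# →
    (∀ {q} → Prime q → q ℕ.∣ N → ¬ (g ^ cofactor N q ≈ 1#)) → ∀ k → g ^ k ≈ 1# → N ℕ.∣ k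
  order-divides g N gᴺ≈1 primitive-root k gᵏ≈1 with gcd[m,n]∣n k N
  ... | ℕ.divides m N≡md with m ℕ.≟ 1
  ... | yes ≡.refl = subst (ℕ._∣ k) (≡.sym (≡.trans N≡md (ℕ.*-identityˡ _))) (gcd[m,n]∣m k N)
  ... | no m≢1 with prime-divisor m≢0 m≢1
    where
    m≢0 : m ≢ 0
    m≢0 ≡.refl = ℕ.≢-nonZero⁻¹ N N≡md
  ... | q , q-prime , ℕ.divides m′ ≡.refl = ⊥-elim (primitive-root q-prime q∣N
          (^-multiple g (ℕ.divides m′ cofactor≡) (^-gcd g k N gᵏ≈1 gᴺ≈1)))
    where
    instance
      q≢0 : ℕ.NonZero q
      q≢0 = prime⇒nonZero q-prime
    d = gcd k N
    N≡q[m′d] : N ≡ q ℕ.* (m′ ℕ.* d)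
    N≡q[m′d] = ≡.trans N≡md (≡.trans (cong (ℕ._* d) (ℕ.*-comm m′ q)) (ℕ.*-assoc q m′ d))
    q∣N : q ℕ.∣ N
    q∣N = subst (q ℕ.∣_) (≡.sym N≡q[m′d]) (ℕ.m∣m*n _)
    cofactor≡ : cofactor N q ≡ m′ ℕ.* d
    cofactor≡ = ℕ.*-cancelˡ-≡ _ _ q (≡.trans (*-cofactor q∣N) N≡q[m′d])

  module _ (g : Carrier) (N : ℕ) .{{_ : ℕ.NonZero N}} (gᴺ≈1 : g ^ N ≈ 1#)
           (order : ∀ k → g ^ k ≈ 1# → N ℕ.∣ k) where
    ^-periodic : ∀ x y → + N ∣ + x ℤ.- + y → g ^ x ≈ g ^ y
    ^-periodic x y N∣ with ℕ.≤-total y x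
    ... | inj₁ y≤x = begin
      g ^ x                    ≡⟨ cong (g ^_) (ℕ.m+[n∸m]≡n y≤x) ⟨
      g ^ (y ℕ.+ (x ℕ.∸ y))    ≈⟨ ^-absorb g y (^-multiple g (∣-∸ y≤x N∣) gᴺ≈1) ⟩
      g ^ y                    ∎
    ... | inj₂ x≤y = sym (begin
      g ^ y                    ≡⟨ cong (g ^_) (ℕ.m+[n∸m]≡n x≤y) ⟨
      g ^ (x ℕ.+ (y ℕ.∸ x))    ≈⟨ ^-absorb g x (^-multiple g (∣-∸ x≤y (flip-∣ {x = + x} {+ y} N∣)) gᴺ≈1) ⟩
      g ^ x                    ∎)

    -- Taking the exponent modulo N covers negative t without inverses.
    E : ℤ → Carrier
    E t = g ^ (t %ℕ N)

    E-+ : ∀ s t → E (s ℤ.+ t) ≈ E s * E t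
    E-+ s t = trans (^-periodic ((s ℤ.+ t) %ℕ N) (s %ℕ N ℕ.+ t %ℕ N)
        (subst (+ N ∣_) (≡.trans (rearrange s t (+ (s %ℕ N)) (+ (t %ℕ N)) (+ ((s ℤ.+ t) %ℕ N)))
                           (cong (λ z → + ((s ℤ.+ t) %ℕ N) ℤ.- z) (≡.sym (ℤ.pos-+ (s %ℕ N) (t %ℕ N)))))
          (∣m∣n⇒∣m-n (∣m∣n⇒∣m+n (residue-∣ N s 0) (residue-∣ N t 0)) (residue-∣ N (s ℤ.+ t) 0))))
      (^-homo-* g (s %ℕ N) (t %ℕ N))
      where
      rearrange : ∀ s t a b c → (s ℤ.- a) ℤ.+ (t ℤ.- b) ℤ.- (s ℤ.+ t ℤ.- c) ≡ c ℤ.- (a ℤ.+ b)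
      rearrange = solve-∀

    E≈1⇒∣ : ∀ {t} → E t ≈ 1# → + N ∣ t
    E≈1⇒∣ {t} Et≈1 = subst (+ N ∣_) (recover t (+ (t %ℕ N)))
      (∣m∣n⇒∣m+n (residue-∣ N t 0) (∣ᵤ⇒∣ {+ N} {+ (t %ℕ N)} (order (t %ℕ N) Et≈1)))
      where
      recover : ∀ t r → (t ℤ.- r) ℤ.+ r ≡ t
      recover = solve-∀

    ∣⇒E≈1 : ∀ {t} → + N ∣ t → E t ≈ 1#
    ∣⇒E≈1 {t} N∣t = ^-periodic (t %ℕ N) 0 (subst (+ N ∣_) (cancel t (+ (t %ℕ N))) (∣m∣n⇒∣m-n N∣t (residue-∣ N t 0)))
      where
      cancel : ∀ t r → t ℤ.- (t ℤ.- r) ≡ r ℤ.- + 0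
      cancel = solve-∀

module _ {N K : ℕ} .{{_ : ℕ.NonZero N}} (P : PrimitivePrime N K) where
  open PrimitivePrime P
  open ResidueRing p
  open CommutativeRing ℤ/p using (semiring)
  open import Algebra.Properties.Semiring.Exp semiring using (_^_)

  ^≡ : ∀ k → (+ base) ^ k ≡ + (base ℕ.^ k)
  ^≡ zero    = ≡.refl
  ^≡ (suc k) = ≡.trans (cong (+ base ℤ.*_) (^≡ k)) (≡.sym (ℤ.pos-* base _))

  ^≈1⇒∣ : ∀ k → (+ base) ^ k ≈ + 1 → p ℕ.∣ base ℕ.^ k ℕ.∸ 1
  ^≈1⇒∣ k (mod d) = ∣⇒∣ᵤ (subst (+ p ∣_) (≡.trans (cong (ℤ._- + 1) (^≡ k)) (≡.sym (ℤ-power-pred base k))) d)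

  ∣⇒^≈1 : ∀ k → p ℕ.∣ base ℕ.^ k ℕ.∸ 1 → (+ base) ^ k ≈ + 1
  ∣⇒^≈1 k d = mod (subst (+ p ∣_) (≡.sym (≡.trans (cong (ℤ._- + 1) (^≡ k)) (≡.sym (ℤ-power-pred base k)))) (∣ᵤ⇒∣ d))

  cyclotomicDomain : CyclotomicDomain N
  cyclotomicDomain = record
    { commutativeRing = ℤ/p
    ; morphism = record
      { ⟦_⟧ = λ i → i ; +-homo = λ _ _ → ≡⇒≈ ≡.refl ; *-homo = λ _ _ → ≡⇒≈ ≡.refl ; -‿homo = λ _ → ≡⇒≈ ≡.refl
      ; 0-homo = ≡⇒≈ ≡.refl ; 1-homo = ≡⇒≈ ≡.refl }
    ; no-zero-divisors = λ {x} {y} xy≈0 → Sum.map (∣⇒≈0 ∘ ∣ᵤ⇒∣) (∣⇒≈0 ∘ ∣ᵤ⇒∣)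
        (euclidsLemma ℤ.∣ x ∣ ℤ.∣ y ∣ prime (subst (p ℕ.∣_) (ℤ.abs-* x y) (∣⇒∣ᵤ (≈0⇒∣ xy≈0))))
    ; 1≉0 = λ 1≈0 → ¬prime[1] (subst Prime (ℕ.∣1⇒≡1 (∣⇒∣ᵤ (≈0⇒∣ 1≈0))) prime)
    ; E = E (+ base) N gᴺ≈1 order
    ; E-+ = E-+ (+ base) N gᴺ≈1 order
    ; E≈1⇒∣ = E≈1⇒∣ (+ base) N gᴺ≈1 order
    ; ∣⇒E≈1 = ∣⇒E≈1 (+ base) N gᴺ≈1 order }
    where
    open PrimitiveRoot ℤ/p
    gᴺ≈1 : (+ base) ^ N ≈ + 1
    gᴺ≈1 = ∣⇒^≈1 N p∣
    order : ∀ k → (+ base) ^ k ≈ + 1 → N ℕ.∣ k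
    order = order-divides (+ base) N gᴺ≈1 λ {q} q-prime q∣N → p∤ q-prime q∣N ∘ ^≈1⇒∣ (cofactor N q)

  divisor≉0 : ∀ {i} → i ℕ.∣ K → ¬ (+ i ≈ + 0)
  divisor≉0 i∣K i≈0 = p∤K (ℕ.∣-trans (∣⇒∣ᵤ (≈0⇒∣ i≈0)) i∣K)

-- Floors and fractional parts of sums of unit fractions.

/-≡ : ∀ i k m n .{{_ : ℕ.NonZero m}} .{{_ : ℕ.NonZero n}} → i ℤ.* + n ≡ k ℤ.* + m → i ℚ./ m ≡ k ℚ./ n
/-≡ i k (suc m) (suc n) eq = ℚ.fromℚᵘ-cong {mkℚᵘ i m} {mkℚᵘ k n} (*≡* eq)

toℚᵘ-/ : ∀ i n → ℚ.toℚᵘ (i ℚ./ suc n) ℚᵘ.≃ mkℚᵘ i n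
toℚᵘ-/ i n = ℚ.toℚᵘ-fromℚᵘ (mkℚᵘ i n)

/-+ : ∀ i k n .{{_ : ℕ.NonZero n}} → (i ℤ.+ k) ℚ./ n ≡ i ℚ./ n ℚ.+ k ℚ./ n
/-+ i k (suc n) = ℚ.toℚᵘ-injective (begin
  ℚ.toℚᵘ ((i ℤ.+ k) ℚ./ suc n)                          ≈⟨ toℚᵘ-/ (i ℤ.+ k) n ⟩
  mkℚᵘ (i ℤ.+ k) n                                      ≈⟨ *≡* (≡.trans (cong (λ z → (i ℤ.+ k) ℤ.* z) (ℤ.pos-* (suc n) (suc n))) (rearrange i k (+ suc n))) ⟩
  mkℚᵘ i n ℚᵘ.+ mkℚᵘ k n                                ≈⟨ ℚᵘ.+-cong (toℚᵘ-/ i n) (toℚᵘ-/ k n) ⟨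
  ℚ.toℚᵘ (i ℚ./ suc n) ℚᵘ.+ ℚ.toℚᵘ (k ℚ./ suc n)        ≈⟨ ℚ.toℚᵘ-homo-+ (i ℚ./ suc n) (k ℚ./ suc n) ⟨
  ℚ.toℚᵘ (i ℚ./ suc n ℚ.+ k ℚ./ suc n)                  ∎)
  where
  open import Relation.Binary.Reasoning.Setoid ℚᵘ.≃-setoid
  rearrange : ∀ i k n → (i ℤ.+ k) ℤ.* (n ℤ.* n) ≡ (i ℤ.* n ℤ.+ k ℤ.* n) ℤ.* n
  rearrange = solve-∀

/1-*-recip : ∀ r n .{{_ : ℕ.NonZero n}} → (+ r ℚ./ 1) ℚ.* recip n ≡ + r ℚ./ n
/1-*-recip r (suc n) = ℚ.toℚᵘ-injective (begin
  ℚ.toℚᵘ ((+ r ℚ./ 1) ℚ.* (+ 1 ℚ./ suc n))                ≈⟨ ℚ.toℚᵘ-homo-* (+ r ℚ./ 1) (+ 1 ℚ./ suc n) ⟩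
  ℚ.toℚᵘ (+ r ℚ./ 1) ℚᵘ.* ℚ.toℚᵘ (+ 1 ℚ./ suc n)          ≈⟨ ℚᵘ.*-cong (toℚᵘ-/ (+ r) 0) (toℚᵘ-/ (+ 1) n) ⟩
  mkℚᵘ (+ r) 0 ℚᵘ.* mkℚᵘ (+ 1) n
    ≈⟨ *≡* (≡.trans (cong (ℤ._* + suc n) (ℤ.*-identityʳ (+ r))) (cong (λ k → + r ℤ.* + k) (≡.sym (ℕ.*-identityˡ (suc n))))) ⟩
  mkℚᵘ (+ r) n                                            ≈⟨ toℚᵘ-/ (+ r) n ⟨
  ℚ.toℚᵘ (+ r ℚ./ suc n)                                  ∎)
  where open import Relation.Binary.Reasoning.Setoid ℚᵘ.≃-setoid

recip-/ : ∀ {n h N} .{{_ : ℕ.NonZero N}} → n ℕ.* h ≡ N → recip n ≡ + h ℚ./ N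
recip-/ {zero}  {h} {suc _} ()
recip-/ {suc n} {h} {N} nh≡N = /-≡ (+ 1) (+ h) (suc n) N (begin
  + 1 ℤ.* + N           ≡⟨ ℤ.*-identityˡ (+ N) ⟩
  + N                   ≡⟨ cong +_ (≡.trans (≡.sym nh≡N) (ℕ.*-comm (suc n) h)) ⟩
  + (h ℕ.* suc n)       ≡⟨ ℤ.pos-* h (suc n) ⟩
  + h ℤ.* + suc n       ∎)
  where open ≡.≡-Reasoning

0/-≡0 : ∀ N .{{_ : ℕ.NonZero N}} → + 0 ℚ./ N ≡ ℚ.0ℚ
0/-≡0 N = /-≡ (+ 0) (+ 0) N 1 ≡.refl

sumInv-/ : ∀ {j N} .{{_ : ℕ.NonZero N}} (n h : Fin j → ℕ) → (∀ s → n s ℕ.* h s ≡ N) → ∀ I →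
  sumInv n I ≡ + subsetSum h I ℚ./ N
sumInv-/ {N = N} n h nh≡N []      = ≡.sym (0/-≡0 N)
sumInv-/ {N = N} n h nh≡N (b ∷ I) = begin
  (if b then recip (n zero) else ℚ.0ℚ) ℚ.+ sumInv (n ∘ suc) I
    ≡⟨ cong₂ ℚ._+_ (first b) (sumInv-/ (n ∘ suc) (h ∘ suc) (nh≡N ∘ suc) I) ⟩
  + (if b then h zero else 0) ℚ./ N ℚ.+ + subsetSum (h ∘ suc) I ℚ./ N
    ≡⟨ /-+ (+ (if b then h zero else 0)) (+ subsetSum (h ∘ suc) I) N ⟨
  + subsetSum h (b ∷ I) ℚ./ N ∎
  where
  open ≡.≡-Reasoning
  first : ∀ b → (if b then recip (n zero) else ℚ.0ℚ) ≡ + (if b then h zero else 0) ℚ./ N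
  first true  = recip-/ {n zero} {h zero} (nh≡N zero)
  first false = ≡.sym (0/-≡0 N)

-- The floor is computed from the numerator and denominator in lowest terms, k and d + 1. Cross
-- multiplication brings both fractions to one denominator, where the natural quotients coincide.
floor-/ : ∀ q N .{{_ : ℕ.NonZero N}} → floor (+ q ℚ./ N) ≡ + (q ℕ./ N)
floor-/ q (suc N) = from-≃ (+ q ℚ./ suc N) (toℚᵘ-/ (+ q) N)
  where
  from-≃ : ∀ p → ℚ.toℚᵘ p ℚᵘ.≃ mkℚᵘ (+ q) N → floor p ≡ + (q ℕ./ suc N)
  from-≃ (ℚ.mkℚ (+ k) d _) (*≡* eq) = ≡.trans (div-pos-is-/ℕ (+ k) (suc d)) (cong +_ (begin
    k ℕ./ suc d                                ≡⟨ ℕ.m*n/o*n≡m/o k (suc N) (suc d) ⟨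
    k ℕ.* suc N ℕ./ (suc d ℕ.* suc N)          ≡⟨ ℕ./-congˡ {o = suc d ℕ.* suc N} (ℤ.+-injective (≡.trans (ℤ.pos-* k (suc N)) (≡.trans eq (≡.sym (ℤ.pos-* q (suc d)))))) ⟩
    q ℕ.* suc d ℕ./ (suc d ℕ.* suc N)          ≡⟨ ℕ./-congʳ {m = q ℕ.* suc d} (ℕ.*-comm (suc d) (suc N)) ⟩
    q ℕ.* suc d ℕ./ (suc N ℕ.* suc d)          ≡⟨ ℕ.m*n/o*n≡m/o q (suc d) (suc N) ⟩
    q ℕ./ suc N                                ∎))
    where open ≡.≡-Reasoning
  from-≃ (ℚ.mkℚ ℤ.-[1+ k ] d _) (*≡* eq) with () ← ≡.trans eq (≡.sym (ℤ.pos-* q (suc d)))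

frac-/ : ∀ {q N n h r} .{{_ : ℕ.NonZero N}} .{{_ : ℕ.NonZero n}} → n ℕ.* h ≡ N → q ℕ.% N ≡ r ℕ.* h →
  frac (+ q ℚ./ N) ≡ (+ r ℚ./ 1) ℚ.* recip n
frac-/ {q} {N} {n} {h} {r} nh≡N q%N≡rh = begin
  + q ℚ./ N ℚ.- floor (+ q ℚ./ N) ℚ./ 1            ≡⟨ cong (λ z → + q ℚ./ N ℚ.- z ℚ./ 1) (floor-/ q N) ⟩
  + q ℚ./ N ℚ.- T                                  ≡⟨ cong (ℚ._- T) (cong (λ k → + k ℚ./ N) (ℕ.m≡m%n+[m/n]*n q N)) ⟩
  + (q ℕ.% N ℕ.+ q ℕ./ N ℕ.* N) ℚ./ N ℚ.- T        ≡⟨ cong (ℚ._- T) (/-+ (+ (q ℕ.% N)) (+ (q ℕ./ N ℕ.* N)) N) ⟩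
  + (q ℕ.% N) ℚ./ N ℚ.+ + (q ℕ./ N ℕ.* N) ℚ./ N ℚ.- T
    ≡⟨ cong₂ (λ x y → x ℚ.+ y ℚ.- T) (≡.trans (cong (λ k → + k ℚ./ N) q%N≡rh) remainder≡) quotient≡ ⟩
  + r ℚ./ n ℚ.+ T ℚ.- T                            ≡⟨ ℚ.+-assoc (+ r ℚ./ n) T (ℚ.- T) ⟩
  + r ℚ./ n ℚ.+ (T ℚ.- T)                          ≡⟨ cong (+ r ℚ./ n ℚ.+_) (ℚ.+-inverseʳ T) ⟩
  + r ℚ./ n ℚ.+ ℚ.0ℚ                               ≡⟨ ℚ.+-identityʳ (+ r ℚ./ n) ⟩
  + r ℚ./ n                                        ≡⟨ /1-*-recip r n ⟨
  (+ r ℚ./ 1) ℚ.* recip n                          ∎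
  where
  open ≡.≡-Reasoning
  T = + (q ℕ./ N) ℚ./ 1
  quotient≡ : + (q ℕ./ N ℕ.* N) ℚ./ N ≡ T
  quotient≡ = /-≡ (+ (q ℕ./ N ℕ.* N)) (+ (q ℕ./ N)) N 1 (≡.trans (ℤ.*-identityʳ _) (ℤ.pos-* (q ℕ./ N) N))
  remainder≡ : + (r ℕ.* h) ℚ./ N ≡ + r ℚ./ n
  remainder≡ = /-≡ (+ (r ℕ.* h)) (+ r) N n (≡.trans (≡.sym (ℤ.pos-* (r ℕ.* h) n)) (≡.trans (cong +_
    (≡.trans (ℕ.*-assoc r h n) (cong (r ℕ.*_) (≡.trans (ℕ.*-comm h n) nh≡N)))) (ℤ.pos-* r N)))

-- Splitting off the last class, and periodicity of covering functions.

w-init : ∀ {j} (a : Fin (suc j) → ℤ) (n : Fin (suc j) → ℕ) x →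
  w a n x ≡ (if does (+ n (fromℕ j) ∣? x ℤ.- a (fromℕ j)) then 1 else 0) ℕ.+ w (a ∘ inject₁) (n ∘ inject₁) x
w-init {zero}  a n x = ≡.refl
w-init {suc j} a n x = ≡.trans
  (cong ((if does (+ n zero ∣? x ℤ.- a zero) then 1 else 0) ℕ.+_) (w-init (a ∘ suc) (n ∘ suc) x))
  (swap (if does (+ n zero ∣? x ℤ.- a zero) then 1 else 0)
        (if does (+ n (fromℕ (suc j)) ∣? x ℤ.- a (fromℕ (suc j))) then 1 else 0)
        (w (a ∘ suc ∘ inject₁) (n ∘ suc ∘ inject₁) x))
  where
  swap : ∀ u v k → u ℕ.+ (v ℕ.+ k) ≡ v ℕ.+ (u ℕ.+ k)
  swap u v k = ≡.trans (≡.sym (ℕ.+-assoc u v k)) (≡.trans (cong (ℕ._+ k) (ℕ.+-comm u v)) (ℕ.+-assoc v u k))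

shift-∣ : ∀ {n x y a} → + n ∣ x ℤ.- y → + n ∣ x ℤ.- a → + n ∣ y ℤ.- a
shift-∣ {n} {x} {y} {a} n∣x-y n∣x-a = subst (+ n ∣_) (cancel x y a) (∣m∣n⇒∣m-n n∣x-a n∣x-y)
  where
  cancel : ∀ x y a → x ℤ.- a ℤ.- (x ℤ.- y) ≡ y ℤ.- a
  cancel = solve-∀

does-periodic : ∀ n {x y} a → + n ∣ x ℤ.- y → does (+ n ∣? x ℤ.- a) ≡ does (+ n ∣? y ℤ.- a)
does-periodic n {x} {y} a n∣ = does-⇔ (mk⇔ (shift-∣ {x = x} {y} {a} n∣) (shift-∣ {x = y} {x} {a} (flip-∣ {x = x} {y} n∣)))
  (+ n ∣? x ℤ.- a) (+ n ∣? y ℤ.- a)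

w-periodic : ∀ {j N} (a : Fin j → ℤ) (n : Fin j → ℕ) → (∀ s → n s ℕ.∣ N) → ∀ {x y} → + N ∣ x ℤ.- y → w a n x ≡ w a n y
w-periodic {zero}  a n n∣N N∣x-y = ≡.refl
w-periodic {suc j} a n n∣N {x} {y} N∣x-y = cong₂ (λ b k → (if b then 1 else 0) ℕ.+ k)
  (does-periodic (n zero) {x} {y} (a zero) (∣-trans (∣ᵤ⇒∣ (n∣N zero)) N∣x-y))
  (w-periodic (a ∘ suc) (n ∘ suc) (n∣N ∘ suc) {x} {y} N∣x-y)

common-multiple : ∀ {k} (n : Fin k → ℕ) → (∀ s → 1 ℕ.≤ n s) → ∃ λ N → ℕ.NonZero N × (∀ s → n s ℕ.∣ N)
common-multiple {zero}  n n≥1 = 1 , _ , λ ()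
common-multiple {suc k} n n≥1 with common-multiple (n ∘ suc) (n≥1 ∘ suc)
... | N , N≢0 , n∣N = n zero ℕ.* N , ℕ.m*n≢0 (n zero) N {{ℕ.>-nonZero (n≥1 zero)}} {{N≢0}}
  , λ { zero → ℕ.m∣m*n N ; (suc s) → ℕ.∣n⇒∣m*n (n zero) (n∣N s) }

-- A negated universal statement yields no witness by itself. Since w has period N, a search through
-- 0, ..., N - 1 decides the matter and finds one.
deficient-point : ∀ {j N m} .{{_ : ℕ.NonZero N}} (a : Fin j → ℤ) (n : Fin j → ℕ) → (∀ s → n s ℕ.∣ N) →
  ¬ IsMCover m a n → ∃ λ x → w a n x ℕ.< m
deficient-point {N = N} {m} a n n∣N ¬cover with ℕ.anyUpTo? (λ i → w a n (+ i) ℕ.<? m) N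
... | yes (i , _ , w<m) = + i , w<m
... | no ¬deficient = ⊥-elim (¬cover λ x → subst (m ℕ.≤_)
  (≡.sym (w-periodic a n n∣N {x} {+ (x %ℕ N)} (residue-∣ N x 0)))
  (ℕ.≮⇒≥ λ w<m → ¬deficient (x %ℕ N , n%ℕd<d x N , w<m)))

-- From lists that fail to capture the exponents to many distinct subset sums.

module DistinctFloors {j N μ : ℕ} .{{N≢0 : ℕ.NonZero N}} (h : Fin j → ℕ) (R : ℕ)
  (uncaptured : (vs : Vec ℕ μ) → ¬ (∀ I → + N ∣ + subsetSum h I ℤ.- + R → subsetSum h I ∈ vs)) where

  Good : Subset j → Set
  Good I = + N ∣ + subsetSum h I ℤ.- + R

  -- A list of full length μ cannot capture all good sums, and the subsets are finite in number, so
  -- a search finds an escaping one.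
  fresh : ∀ k {d} (vs : Vec ℕ d) → k ℕ.+ d ≡ μ → ∃ λ I → Good I × ¬ (subsetSum h I ∈ vs)
  fresh zero vs ≡.refl with anySubset? (λ I → (+ N ∣? + subsetSum h I ℤ.- + R) ×-dec ¬? (subsetSum h I ∈? vs))
  ... | yes found = found
  ... | no ¬found = ⊥-elim (uncaptured vs λ I good →
    decidable-stable (subsetSum h I ∈? vs) λ ∉vs → ¬found (I , good , ∉vs))
  -- A shorter list is padded with the arbitrary value 0: avoiding more values does no harm.
  fresh (suc k) {d} vs eq with fresh k (0 ∷ vs) (≡.trans (ℕ.+-suc k d) eq)
  ... | I , good , ∉0∷vs = I , good , ∉0∷vs ∘ there

  -- Greedy choice: as long as at most μ subsets have been chosen, their sums form a list to which
  -- `fresh` applies, so the choice reaches μ + 1.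
  family : ∀ l → l ℕ.≤ suc μ → Σ (Fin l → Subset j) λ F → (∀ i → Good (F i)) ×
    (∀ i i′ → subsetSum h (F i) ≡ subsetSum h (F i′) → i ≡ i′)
  family zero    l≤ = (λ ()) , (λ ()) , λ ()
  family (suc l) l≤ with family l (ℕ.<⇒≤ l≤)
  ... | F , good , distinct with fresh (μ ℕ.∸ l) (tabulate (subsetSum h ∘ F)) (ℕ.m∸n+n≡m (ℕ.s≤s⁻¹ l≤))
  ... | I , good′ , new = F′ , good″ , distinct′
    where
    F′ : Fin (suc l) → Subset j
    F′ zero    = I
    F′ (suc i) = F i
    good″ : ∀ i → Good (F′ i)
    good″ zero    = good′
    good″ (suc i) = good i
    distinct′ : ∀ i i′ → subsetSum h (F′ i) ≡ subsetSum h (F′ i′) → i ≡ i′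
    distinct′ zero    zero     eq = ≡.refl
    distinct′ zero    (suc i′) eq = ⊥-elim (new (subst (_∈ _) (≡.sym eq) (∈-tabulate⁺ (subsetSum h ∘ F) i′)))
    distinct′ (suc i) zero     eq = ⊥-elim (new (subst (_∈ _) eq (∈-tabulate⁺ (subsetSum h ∘ F) i)))
    distinct′ (suc i) (suc i′) eq = cong suc (distinct i i′ eq)

  good-% : R ℕ.< N → ∀ I → Good I → subsetSum h I ℕ.% N ≡ R
  good-% R<N I good = residue-unique (ℕ.m%n<n (subsetSum h I) N) R<N
    (shift-∣ {x = + subsetSum h I} {+ (subsetSum h I ℕ.% N)} {+ R} (residue-∣ N (+ subsetSum h I) 0) good)

-- The cover without its irredundant class, and the final count.

module Cover (j μ : ℕ) (a : Fin (suc j) → ℤ) (n : Fin (suc j) → ℕ)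
  (cover : IsMCover (suc μ) a n)
  (irredundant : ¬ IsMCover (suc μ) (λ s → a (inject₁ s)) (λ s → n (inject₁ s)))
  (periodic : ∀ x → w a n (x ℤ.+ + n (fromℕ j)) ≡ w a n x)
  (N : ℕ) .{{N≢0 : ℕ.NonZero N}} (n∣N : ∀ s → n s ℕ.∣ N) where

  n₀ : ℕ
  n₀ = n (fromℕ j)

  a₀ : ℤ
  a₀ = a (fromℕ j)

  a′ : Fin j → ℤ
  a′ = a ∘ inject₁

  n′ : Fin j → ℕ
  n′ = n ∘ inject₁

  complement : Fin (suc j) → ℕ
  complement s = ℕ.quotient (n∣N s)

  *-complement : ∀ s → n s ℕ.* complement s ≡ N
  *-complement s = ≡.sym (ℕ.m∣n⇒n≡m*quotient (n∣N s))

  -- K = N μ! is chosen so that every integer that must be nonzero in the domain, namely all N/n_s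
  -- and μ!, is one of its divisors.
  complement∣K : ∀ s → complement s ℕ.∣ N ℕ.* μ !
  complement∣K s = ℕ.∣m⇒∣m*n (μ !) (ℕ.quotient-∣ (n∣N s))

  h : Fin j → ℕ
  h = complement ∘ inject₁

  h₀ : ℕ
  h₀ = complement (fromℕ j)

  n₀≢0 : ℕ.NonZero n₀
  n₀≢0 = ℕ.≢-nonZero λ n₀≡0 → ℕ.≢-nonZero⁻¹ N (≡.trans (≡.sym (*-complement (fromℕ j))) (cong (ℕ._* h₀) n₀≡0))

  h₀≢0 : ℕ.NonZero h₀
  h₀≢0 = ℕ.≢-nonZero λ h₀≡0 → ℕ.≢-nonZero⁻¹ N
    (≡.trans (≡.sym (*-complement (fromℕ j))) (≡.trans (cong (n₀ ℕ.*_) h₀≡0) (ℕ.*-zeroʳ n₀)))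

  hit : ∀ {x} → + n₀ ∣ x ℤ.- a₀ → w a n x ≡ suc (w a′ n′ x)
  hit {x} n₀∣ = ≡.trans (w-init a n x)
    (cong (λ b → (if b then 1 else 0) ℕ.+ w a′ n′ x) (dec-true (+ n₀ ∣? x ℤ.- a₀) n₀∣))

  miss : ∀ {x} → ¬ (+ n₀ ∣ x ℤ.- a₀) → w a n x ≡ w a′ n′ x
  miss {x} n₀∤ = ≡.trans (w-init a n x)
    (cong (λ b → (if b then 1 else 0) ℕ.+ w a′ n′ x) (dec-false (+ n₀ ∣? x ℤ.- a₀) n₀∤))

  periodic′ : ∀ x → w a′ n′ (x ℤ.+ + n₀) ≡ w a′ n′ x
  periodic′ x = ℕ.+-cancelˡ-≡ (if does (+ n₀ ∣? x ℤ.- a₀) then 1 else 0) _ _ (begin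
    (if does (+ n₀ ∣? x ℤ.- a₀) then 1 else 0) ℕ.+ w a′ n′ (x ℤ.+ + n₀)
      ≡⟨ cong (λ b → (if b then 1 else 0) ℕ.+ w a′ n′ (x ℤ.+ + n₀))
           (does-periodic n₀ {x} {x ℤ.+ + n₀} a₀ (divides (ℤ.- + 1) (step x (+ n₀)))) ⟩
    (if does (+ n₀ ∣? x ℤ.+ + n₀ ℤ.- a₀) then 1 else 0) ℕ.+ w a′ n′ (x ℤ.+ + n₀)   ≡⟨ w-init a n (x ℤ.+ + n₀) ⟨
    w a n (x ℤ.+ + n₀)                                                            ≡⟨ periodic x ⟩
    w a n x                                                                       ≡⟨ w-init a n x ⟩
    (if does (+ n₀ ∣? x ℤ.- a₀) then 1 else 0) ℕ.+ w a′ n′ x                       ∎)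
    where
    open ≡.≡-Reasoning
    step : ∀ x n → x ℤ.- (x ℤ.+ n) ≡ ℤ.- + 1 ℤ.* n
    step = solve-∀

  over : ∀ x → ¬ (+ n₀ ∣ x ℤ.- a₀) → μ ℕ.< w a′ n′ x
  over x n₀∤ = subst (suc μ ℕ.≤_) (miss n₀∤) (cover x)

  -- Irredundancy yields a single point with at most μ of the remaining classes. By `over` it lies
  -- in the removed class, where the cover leaves at least μ; periodicity carries the value μ to the
  -- whole class.
  exact : ∀ x → + n₀ ∣ x ℤ.- a₀ → w a′ n′ x ≡ μ
  exact x n₀∣ with deficient-point a′ n′ (n∣N ∘ inject₁) irredundant
  ... | x₀ , w<m with + n₀ ∣? x₀ ℤ.- a₀
  ... | no n₀∤   = ⊥-elim (ℕ.<⇒≱ w<m (over x₀ n₀∤))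
  ... | yes n₀∣x₀ = ≡.trans
    (periodic⇒∣ (w a′ n′) n₀ periodic′ {x} {x₀} (subst (+ n₀ ∣_) (cancel x a₀ x₀) (∣m∣n⇒∣m-n n₀∣ n₀∣x₀)))
    (ℕ.≤-antisym (ℕ.s≤s⁻¹ w<m) (ℕ.s≤s⁻¹ (subst (suc μ ℕ.≤_) (hit n₀∣x₀) (cover x₀))))
    where
    cancel : ∀ x a y → x ℤ.- a ℤ.- (y ℤ.- a) ≡ x ℤ.- y
    cancel = solve-∀

  uncaptured : (D : CyclotomicDomain N) → Cyclotomic.NonzeroDivisors D (N ℕ.* μ !) →
    ∀ r (vs : Vec ℕ μ) → ¬ (∀ I → + N ∣ + subsetSum h I ℤ.- + (r ℕ.* h₀) → subsetSum h I ∈ vs)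
  uncaptured D divisor≉0 r vs = CoverSums.not-captured D a′ n′ h (*-complement ∘ inject₁) a₀ n₀ h₀ (*-complement (fromℕ j)) μ
    exact over periodic′ (λ s → divisor≉0 (complement∣K (inject₁ s))) (divisor≉0 (complement∣K (fromℕ j)))
    (divisor≉0 (ℕ.n∣m*n N)) r vs

  subsets : (D : CyclotomicDomain N) → Cyclotomic.NonzeroDivisors D (N ℕ.* μ !) →
    ∀ r → r ℕ.< n₀ → Σ (Fin (suc μ) → Subset j) λ I →
    (∀ i → frac (sumInv n′ (I i)) ≡ (+ r ℚ./ 1) ℚ.* recip n₀)
    × (∀ i i′ → floor (sumInv n′ (I i)) ≡ floor (sumInv n′ (I i′)) → i ≡ i′)
  subsets D divisor≉0 r r<n₀ = F , fractional , floors
    where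
    open DistinctFloors h (r ℕ.* h₀) (uncaptured D divisor≉0 r)
    F = proj₁ (family (suc μ) ℕ.≤-refl)
    good = proj₁ (proj₂ (family (suc μ) ℕ.≤-refl))
    distinct = proj₂ (proj₂ (family (suc μ) ℕ.≤-refl))
    rh₀<N : r ℕ.* h₀ ℕ.< N
    rh₀<N = subst (r ℕ.* h₀ ℕ.<_) (*-complement (fromℕ j)) (ℕ.*-monoˡ-< h₀ {{h₀≢0}} r<n₀)
    q : Fin (suc μ) → ℕ
    q i = subsetSum h (F i)
    value : ∀ i → sumInv n′ (F i) ≡ + q i ℚ./ N
    value i = sumInv-/ n′ h (*-complement ∘ inject₁) (F i)
    q% : ∀ i → q i ℕ.% N ≡ r ℕ.* h₀
    q% i = good-% rh₀<N (F i) (good i)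
    fractional : ∀ i → frac (sumInv n′ (F i)) ≡ (+ r ℚ./ 1) ℚ.* recip n₀
    fractional i = ≡.trans (cong frac (value i)) (frac-/ {q i} {N} {n₀} {h₀} {r} {{N≢0}} {{n₀≢0}} (*-complement (fromℕ j)) (q% i))
    floor-value : ∀ i → floor (sumInv n′ (F i)) ≡ + (q i ℕ./ N)
    floor-value i = ≡.trans (cong floor (value i)) (floor-/ (q i) N)
    floors : ∀ i i′ → floor (sumInv n′ (F i)) ≡ floor (sumInv n′ (F i′)) → i ≡ i′
    -- All q i have the same remainder r h₀ modulo N, so equal quotients, which are the floors,
    -- force equal sums.
    floors i i′ eq = distinct i i′ (begin
      q i                                    ≡⟨ ℕ.m≡m%n+[m/n]*n (q i) N ⟩
      q i ℕ.% N ℕ.+ q i ℕ./ N ℕ.* N          ≡⟨ cong₂ (λ s t → s ℕ.+ t ℕ.* N) (≡.trans (q% i) (≡.sym (q% i′)))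
                                                  (ℤ.+-injective (≡.trans (≡.sym (floor-value i)) (≡.trans eq (floor-value i′)))) ⟩
      q i′ ℕ.% N ℕ.+ q i′ ℕ./ N ℕ.* N        ≡⟨ ℕ.m≡m%n+[m/n]*n (q i′) N ⟨
      q i′                                   ∎)
      where open ≡.≡-Reasoning

open import Data.Nat using (_≤_; _<_)
open import Data.Integer using (_+_)
open import Data.Rational using (_*_) renaming (_/_ to _/ℚ_)

theorem1 : (j m : ℕ) → 1 ≤ m → (a : Fin (suc j) → ℤ) → (n : Fin (suc j) → ℕ) →
    (∀ s → 1 ≤ n s) →
    IsMCover m a n →
    ¬ IsMCover m (λ s → a (inject₁ s)) (λ s → n (inject₁ s)) →
    (∀ (x : ℤ) → w a n (x + + n (fromℕ j)) ≡ w a n x) →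
    (r : ℕ) → r < n (fromℕ j) →
    Σ (Fin m → Subset j) (λ I →
    (∀ i → frac (sumInv (λ s → n (inject₁ s)) (I i)) ≡ ((+ r) /ℚ 1) * recip (n (fromℕ j)))
    × (∀ i i′ → floor (sumInv (λ s → n (inject₁ s)) (I i)) ≡ floor (sumInv (λ s → n (inject₁ s)) (I i′)) → i ≡ i′))
theorem1 j (suc μ) _ a n n≥1 cover irredundant periodic with common-multiple n n≥1
... | N , N≢0 , n∣N = Cover.subsets j μ a n cover irredundant periodic N {{N≢0}} n∣N (cyclotomicDomain {{N≢0}} P) (divisor≉0 {{N≢0}} P)
  where
  P : PrimitivePrime N (N ℕ.* μ !)
  P = primitive-prime N (N ℕ.* μ !) {{N≢0}} {{ℕ.m*n≢0 N (μ !) {{N≢0}} {{μ ℕ.!≢0}}}}
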